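{- Let $m:\mathbb N\times\mathbb N\to\mathbb N$ be any function and let $\mathcal F=\{f_{N,k}:\{0,1\}^{m(N,k)\times k}\to\{0,1\}\}_{N,k\in\mathbb N}$ be a family of Boolean functions indexed by $N,k$. Suppose that there exists a $(w,r,\ell,s)$-efficient protocol for $f_{N,k}$ in the $k$-player simultaneous message passing model for every $N,k\in\mathbb N$ (where $w,r,\ell,s$ can depend on $N$ and $k$). Then there is a reduction from any instance $(A_1,\dots,A_k)$ of $\mathrm{PSP}(k,\mathcal F,N)$ to $2^w$ label cover instances $\{\Gamma^\mu\}_{\mu\in\{0,1\}^w}$ such that: (1) the running time of the reduction is $2^{w+r+\ell k}\,\mathrm{poly}(m(N,k))$; (2) each $\Gamma^\mu=(U^\mu=U^\mu_1\cup\dots\cup U^\mu_q,\ W^\mu=W^\mu_1\cup\dots\cup W^\mu_h;\ E^\mu)$ has at most $Nk$ right nodes ($|W^\mu|\le Nk$), has $h=k$ right super-nodes, has $q=2^r$ left super-nodes, and has left alphabet size at most $2^{\ell k}$ ($|U^\mu_1|,\dots,|U^\mu_q|\le 2^{\ell k}$); (3) if $(A_1,\dots,A_k)$ is a YES instance of $\mathrm{PSP}(k,\mathcal F,N)$, then $\mathrm{MaxCover}(\Gamma^\mu)=1$ for some $\mu\in\{0,1\}^w$; (4) if $(A_1,\dots,A_k)$ is a NO instance of $\mathrm{PSP}(k,\mathcal F,N)$, then $\mathrm{MaxCover}(\Gamma^\mu)\le s$ for every $\mu\in\{0,1\}^w$.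
   Context: Product space problem: an instance of $\mathrm{PSP}(k,\mathcal F,N)$ consists of $k$ explicitly listed subsets $A_1,\dots,A_k\subseteq\{0,1\}^{m(N,k)}$, each of cardinality at most $N$; it is a YES instance if there is $(a_1,\dots,a_k)\in A_1\times\cdots\times A_k$ with $f_{N,k}(a_1,\dots,a_k)=1$, and a NO instance otherwise. Label cover and MaxCover: a label cover instance $\Gamma$ is a bipartite graph $(U,W;E)$ with $U$ partitioned into $U_1\cup\dots\cup U_q$ (left super-nodes) and $W$ partitioned into $W_1\cup\dots\cup W_h$ (right super-nodes). A labeling is a set $S\subseteq W$ with $|S\cap W_j|=1$ for all $j\in[h]$. A labeling $S$ covers $U_i$ if some $u\in U_i$ is adjacent to every vertex of $S$. $\mathrm{MaxCover}(\Gamma)$ is the maximum over labelings $S$ of the fraction of left super-nodes covered by $S$. The left alphabet size is $\max_i|U_i|$. Efficient protocols: let $f:\{0,1\}^{m\times k}\to\{0,1\}$. In the $k$-player simultaneous message passing (SMP) model, player $i$ holds $x_i\in\{0,1\}^m$, and a referee, who holds an advice string, must decide whether $f(x_1,\dots,x_k)=1$. A $(w,r,\ell,s)$-efficient protocol is one in which: the referee receives $w$ bits of advice; the players and the referee jointly toss $r$ public random coins; each player, as a deterministic function of its input and the coins, sends an $\ell$-bit message to the referee; based on the advice, the coins and the $\ell k$ bits received, the referee accepts or rejects; if $f(x_1,\dots,x_k)=1$ then there is an advice on which the referee always accepts; if $f(x_1,\dots,x_k)=0$ then on any advice the referee accepts with probability at most $s$; and the players and the referee perform all their computations in $\mathrm{poly}(m)$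 time.
   Formalization: The running time proved is 2^{w+r+ℓk}·(N+1)(k+1)·poly(m) instead of 2^{w+r+ℓk}·poly(m), which fails for N superpolynomial in m since all N listed strings must be read; also s ≥ 0 is assumed. -}

module Defs where

open import Data.Bool using (Bool; true; false; T; T?)
open import Data.Fin using (Fin; zero; suc; toℕ)
open import Data.Fin.Properties using (any?; all?)
open import Data.Integer using (+_)
open import Data.List using (List; []; _∷_; _++_; map; foldr; filter; length; replicate; concatMap; allFin; tabulate)
open import Data.List.Membership.Propositional using (_∈_)
open import Data.List.Relation.Unary.Unique.Propositional using (Unique)
open import Data.Nat using (ℕ; zero; suc; _+_; _*_; _^_; _≤_; NonZero)
open import Data.Nat.Binary using (ℕᵇ; zero; 2[1+_]; 1+[2_]; fromℕ)
open import Data.Nat.Properties using (m^n≢0)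
open import Data.Product using (∃; ∃-syntax; _×_; _,_)
open import Data.Rational using (ℚ; 0ℚ; _/_; _⊔_) renaming (_≤_ to _≤ℚ_; _<_ to _<ℚ_)
open import Data.Vec using (Vec; []; _∷_; lookup; toList) renaming (tabulate to tabulateᵛ)
open import Relation.Binary.PropositionalEquality using (_≡_)
open import Relation.Nullary using (¬_; Dec)

------------------------------------------------------------------------
-- Real numbers

-- A real number s, given by its closed lower cut { q ∈ ℚ ∣ q ≤ s }.
-- Only comparisons q ≤ s with q rational are ever needed.

record ℝ : Set₁ where
  field
    Below     : ℚ → Set
    inhabited : ∃ Below
    bounded   : ∃[ q ] ¬ Below q
    downward  : ∀ {p q} → p ≤ℚ q → Below q → Below p
    closed    : ∀ {q} → (∀ {p} → p <ℚ q → Below p) → Below q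

infix 4 _≤ℝ_

_≤ℝ_ : ℚ → ℝ → Set
q ≤ℝ s = ℝ.Below s q

------------------------------------------------------------------------
-- Bit strings

Bits : ℕ → Set
Bits = Vec Bool

-- {0,1}ⁿ in lexicographic order.

allBits : ∀ n → List (Bits n)
allBits zero    = [] ∷ []
allBits (suc n) = map (false ∷_) (allBits n) ++ map (true ∷_) (allBits n)

------------------------------------------------------------------------
-- Model of computation

-- Time is measured on WHILE programs over binary trees (the language of
-- N. D. Jones, "Computability and Complexity"), written without
-- variables: a program transforms a single tree.  As usual for this
-- model, trees are pointers, so forming or taking apart a cell is one
-- step; the only atom is nil, so equality of trees is not primitive.
-- The model is polynomially equivalent to Turing machines and RAMs.

infixr 5 _∙_

data Tree : Set where
  nil : Tree
  _∙_ : Tree → Tree → Tree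

size : Tree → ℕ
size nil     = 1
size (x ∙ y) = suc (size x + size y)

infixr 4 _⨾_

data Prog : Set where
  skip     : Prog
  const    : Prog                        -- constantly nil
  hd tl    : Prog
  cons     : Prog → Prog → Prog          -- run both on the same input
  _⨾_      : Prog → Prog → Prog
  cond     : Prog → Prog → Prog → Prog
  while    : Prog → Prog → Prog          -- nil is false, all else is true

-- P ⊢ x ⇓ y [ n ]: on input x, P halts with y after n steps.

infix 3 _⊢_⇓_[_]

data _⊢_⇓_[_] : Prog → Tree → Tree → ℕ → Set where
  skip       : ∀ {x} → skip ⊢ x ⇓ x [ 1 ]
  const      : ∀ {x} → const ⊢ x ⇓ nil [ 1 ]
  hd-nil     : hd ⊢ nil ⇓ nil [ 1 ]
  hd-∙       : ∀ {x y} → hd ⊢ x ∙ y ⇓ x [ 1 ]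
  tl-nil     : tl ⊢ nil ⇓ nil [ 1 ]
  tl-∙       : ∀ {x y} → tl ⊢ x ∙ y ⇓ y [ 1 ]
  cons       : ∀ {P Q x y z a b} →
               P ⊢ x ⇓ y [ a ] → Q ⊢ x ⇓ z [ b ] →
               cons P Q ⊢ x ⇓ y ∙ z [ suc (a + b) ]
  _⨾_        : ∀ {P Q x y z a b} →
               P ⊢ x ⇓ y [ a ] → Q ⊢ y ⇓ z [ b ] →
               P ⨾ Q ⊢ x ⇓ z [ suc (a + b) ]
  cond-true  : ∀ {B P Q x y u v a b} →
               B ⊢ x ⇓ u ∙ v [ a ] → P ⊢ x ⇓ y [ b ] →
               cond B P Q ⊢ x ⇓ y [ suc (a + b) ]
  cond-false : ∀ {B P Q x y a b} →
               B ⊢ x ⇓ nil [ a ] → Q ⊢ x ⇓ y [ b ] →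
               cond B P Q ⊢ x ⇓ y [ suc (a + b) ]
  while-stop : ∀ {B P x a} →
               B ⊢ x ⇓ nil [ a ] →
               while B P ⊢ x ⇓ x [ suc a ]
  while-step : ∀ {B P x y z u v a b c} →
               B ⊢ x ⇓ u ∙ v [ a ] → P ⊢ x ⇓ y [ b ] →
               while B P ⊢ y ⇓ z [ c ] →
               while B P ⊢ x ⇓ z [ suc (a + b + c) ]

-- Because subtrees may be shared, the cost of writing the result out in
-- full is charged on top of the steps.

Computes : Prog → Tree → Tree → ℕ → Set
Computes P x y t = ∃[ n ] (P ⊢ x ⇓ y [ n ]) × n + size y ≤ t

-- poly (c , d) ranges over a cofinal family of polynomials: every
-- polynomial in n is at most c·(n+1)ᵈ for some c and d.

poly : ℕ × ℕ → ℕ → ℕ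
poly (c , d) n = c * suc n ^ d

encBit : Bool → Tree
encBit false = nil
encBit true  = nil ∙ nil

encList : List Tree → Tree
encList = foldr _∙_ nil

encBits : ∀ {n} → Bits n → Tree
encBits x = encList (map encBit (toList x))

encUnary : ℕ → Tree
encUnary n = encList (replicate n nil)

-- Least significant digit first; the digits of ℕᵇ are 1 and 2.

encBinary : ℕ → Tree
encBinary n = go (fromℕ n)
  where
  go : ℕᵇ → Tree
  go zero     = nil
  go 1+[2 b ] = encBit false ∙ go b
  go 2[1+ b ] = encBit true ∙ go b

------------------------------------------------------------------------
-- The product space problem

-- Each subset is listed explicitly, without repetitions.

record Instance (m k N : ℕ) : Set where
  field
    A      : Vec (List (Bits m)) k
    unique : ∀ j → Unique (lookup A j)
    card≤N : ∀ j → length (lookup A j) ≤ N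

YES : ∀ {m k N} → (Vec (Bits m) k → Bool) → Instance m k N → Set
YES f I = ∃[ a ] (∀ j → lookup a j ∈ lookup (Instance.A I) j) × f a ≡ true

NO : ∀ {m k N} → (Vec (Bits m) k → Bool) → Instance m k N → Set
NO f I = ¬ YES f I

encInstance : ∀ {m k N} → Instance m k N → Tree
encInstance I =
  encList (map (λ Aⱼ → encList (map encBits Aⱼ)) (toList (Instance.A I)))

------------------------------------------------------------------------
-- Label cover

-- Both vertex sets come partitioned: U = ⨄ᵢ Uᵢ with ∣Uᵢ∣ = left i, and
-- W = ⨄ⱼ Wⱼ with ∣Wⱼ∣ = right j.

record LabelCover : Set where
  field
    q h         : ℕ
    .{{q≢0}}    : NonZero q
    left        : Fin q → ℕ
    right       : Fin h → ℕ
    adjacent    : ∀ i → Fin (left i) → ∀ j → Fin (right j) → Bool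

-- A labeling is determined by its single element in each Wⱼ.

Choice : ∀ {h} → (Fin h → ℕ) → Set
Choice n = ∀ j → Fin (n j)

allChoices : ∀ {h} (n : Fin h → ℕ) → List (Choice n)
allChoices {zero}  n = (λ ()) ∷ []
allChoices {suc h} n =
  concatMap (λ v → map (extend v) (allChoices (λ j → n (suc j)))) (allFin (n zero))
  where
  extend : Fin (n zero) → Choice (λ j → n (suc j)) → Choice n
  extend v S zero    = v
  extend v S (suc j) = S j

module _ (Γ : LabelCover) where
  open LabelCover Γ

  Labeling : Set
  Labeling = Choice right

  Covers : Labeling → Fin q → Set
  Covers S i = ∃[ u ] ∀ j → T (adjacent i u j (S j))

  covers? : ∀ S i → Dec (Covers S i)
  covers? S i = any? λ u → all? λ j → T? (adjacent i u j (S j))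

  coveredFraction : Labeling → ℚ
  coveredFraction S = + length (filter (covers? S) (allFin q)) / q

  -- The value is 0 if there is no labeling, i.e. if some Wⱼ is empty.

  MaxCover : ℚ
  MaxCover = foldr _⊔_ 0ℚ (map coveredFraction (allChoices right))

  -- The sizes ∣Wⱼ∣, then for each i, u ∈ Uᵢ, j and v ∈ Wⱼ (nested in
  -- this order) the adjacency bit of u and v.

  encLabelCover : Tree
  encLabelCover =
    encList (tabulate λ j → encUnary (right j)) ∙
    encList (tabulate λ i → encList (tabulate λ u →
      encList (tabulate λ j → encList (tabulate λ v →
        encBit (adjacent i u j v)))))

------------------------------------------------------------------------
-- Simultaneous message passing

record Protocol (k m w r ℓ : ℕ) : Set where
  field
    message : Fin k → Bits m → Bits r → Bits ℓ
    referee : Bits w → Bits r → Vec (Bits ℓ) k → Bool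

  accepts : Bits w → Vec (Bits m) k → Bits r → Bool
  accepts μ x γ = referee μ γ (tabulateᵛ λ j → message j (lookup x j) γ)

  acceptanceProbability : Bits w → Vec (Bits m) k → ℚ
  acceptanceProbability μ x =
    (+ length (filter (λ γ → T? (accepts μ x γ)) (allBits r)) / 2 ^ r) {{m^n≢0 2 r}}

  Complete : (Vec (Bits m) k → Bool) → Set
  Complete f = ∀ x → f x ≡ true → ∃[ μ ] ∀ γ → accepts μ x γ ≡ true

  Sound : (Vec (Bits m) k → Bool) → ℝ → Set
  Sound f s = ∀ x → f x ≡ false → ∀ μ → acceptanceProbability μ x ≤ℝ s

-- The parameters of the protocol, known to all parties.  They need not be
-- computable functions of N and k.  All but N are lengths of strings or
-- lists that are handled anyway and are therefore given in unary.

encParams : (N k m w r ℓ : ℕ) → Tree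
encParams N k m w r ℓ =
  encList (encBinary N ∷ encUnary k ∷ encUnary m ∷
           encUnary w ∷ encUnary r ∷ encUnary ℓ ∷ [])

-- (w,r,ℓ,s)-efficient protocols for all f_{N,k}.  Polynomial time is
-- meaningful only for the family as a whole: one program for the players
-- and one for the referee serve all N and k.

record EfficientProtocols
    (m : ℕ → ℕ → ℕ)
    (f : ∀ N k → Vec (Bits (m N k)) k → Bool)
    (w r ℓ : ℕ → ℕ → ℕ)
    (s : ℕ → ℕ → ℝ) : Set where
  field
    protocol : ∀ N k → Protocol k (m N k) (w N k) (r N k) (ℓ N k)
    complete : ∀ N k → Protocol.Complete (protocol N k) (f N k)
    sound    : ∀ N k → Protocol.Sound (protocol N k) (f N k) (s N k)

  params : ℕ → ℕ → Tree
  params N k = encParams N k (m N k) (w N k) (r N k) (ℓ N k)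

  field
    playerProg refereeProg : Prog
    time                   : ℕ × ℕ
    player-time  : ∀ N k i x γ →
      Computes playerProg
        (encList (params N k ∷ encUnary (toℕ i) ∷ encBits x ∷ encBits γ ∷ []))
        (encBits (Protocol.message (protocol N k) i x γ))
        (poly time (m N k))
    referee-time : ∀ N k μ γ z →
      Computes refereeProg
        (encList (params N k ∷ encBits μ ∷ encBits γ ∷
                  encList (map encBits (toList z)) ∷ []))
        (encBit (Protocol.referee (protocol N k) μ γ z))
        (poly time (m N k))

{-# OPTIONS --safe #-}
module Submission where

-- The left vertices in the block of a random string γ are the tuples z of
-- messages that the referee accepts under the advice μ and the coins γ; the
-- vertex x of the j-th right super-node is adjacent to z if player j sends zⱼ
-- on input x.  A labeling is a choice of inputs x₁, …, x_k, and it covers the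
-- block of γ iff the referee accepts on it, so MaxCover is the maximal
-- acceptance probability under μ.  For the running time, all lists of bit
-- strings and tuples are generated with shared tails, so that a list costs no
-- more than its length: w and r need not be bounded by a polynomial in m.

open import Defs
open import Data.Bool using (Bool; true; false; T; T?; if_then_else_)
open import Data.Bool.Properties using (T-≡; ¬-not)
open import Data.Fin using (Fin; zero; suc; toℕ)
import Data.Integer as ℤ
import Data.Integer.Properties as ℤ
open import Data.List using (List; []; _∷_; _++_; map; sum; tabulate; length; reverse; _ʳ++_; filterᵇ; filter; foldr; replicate; cartesianProductWith; allFin; lookup)
open import Data.List.Membership.Propositional using (_∈_; lose)
open import Data.List.Membership.Propositional.Properties using (∈-map⁺; ∈-++⁺ˡ; ∈-++⁺ʳ; ∈-concatMap⁺; ∈-cartesianProductWith⁺; ∈-allFin; ∈-filter⁺; ∈-filter⁻; ∈-lookup)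
open import Data.List.Properties using (reverse-involutive; length-reverse; map-∘; map-cong; map-replicate; length-replicate; length-++; length-map; map-tabulate; tabulate-lookup; tabulate-cong; length-tabulate; length-filter; filter-all)
import Data.List.Relation.Unary.All as All
open import Data.List.Relation.Unary.Any using (here; there; index)
open import Data.List.Relation.Unary.Any.Properties using (lookup-index)
open import Data.Nat using (ℕ; zero; suc; _+_; _*_; _^_; _≤_; z≤n; s≤s; NonZero; >-nonZero)
open import Data.Nat.Properties
open import Data.Nat.Tactic.RingSolver using (solve-∀)
open import Data.Product using (∃-syntax; Σ-syntax; _×_; _,_; proj₁; proj₂)
open import Data.Rational as ℚ using (ℚ; 0ℚ; 1ℚ; _/_; _⊔_)
import Data.Rational.Properties as ℚ
open import Data.Rational.Unnormalised using (mkℚᵘ; *≤*; *≡*)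
import Data.Rational.Unnormalised.Properties as ℚᵘ
open import Data.Sum using (inj₁; inj₂)
open import Data.Unit using (⊤; tt)
open import Data.Vec as Vec using (Vec; []; _∷_; toList; zip)
open import Data.Vec.Properties using (length-toList; lookup∘tabulate; tabulate∘lookup) renaming (tabulate-cong to tabulateᵛ-cong)
open import Function using (_∘_; id; _⇔_; mk⇔; Equivalence)
open import Relation.Binary.PropositionalEquality using (_≡_; refl; sym; trans; cong; cong₂; subst; subst₂)
open import Relation.Nullary using (yes; no; contradiction)
open import Relation.Unary using (Decidable)

-- Asymptotic running times

-- The delicate point is the running time: `2 ^ (w + r + ℓ k)` leaves no room for stray factors. A
-- factor `ℓ` does arise, since trees have no primitive equality and comparing two messages means
-- walking through them. It is absorbed because `Computes` charges a player for writing its message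
-- out, so `ℓ` lies below the polynomial in `m` wherever there is a message to compare. The factor
-- `(N + 1)(k + 1)` is the number of right vertices, with successors to keep it positive: the output
-- holds one adjacency bit for each left and right vertex, and nothing bounds `N` or `k` by a
-- polynomial in `m`. All constants have to be independent of `N`, `k` and the instance. Running
-- times are therefore stated for families of inputs over an index set `Ω`, and inside a loop `Ω` is
-- extended by the current element and the lists around it. Bounds are at least 1, so that the extra
-- step of each program construct disappears into the constant.

record Bound (Ω : Set) : Set where
  field
    at  : Ω → ℕ
    pos : ∀ ω → 1 ≤ at ω

open Bound

infixl 7 _⊗_
infixl 9 _∘ᵇ_

unit : ∀ {Ω} → Bound Ω
unit = record { at = λ _ → 1 ; pos = λ _ → ≤-refl }

_⊗_ : ∀ {Ω} → Bound Ω → Bound Ω → Bound Ω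
X ⊗ Y = record { at = λ ω → at X ω * at Y ω ; pos = λ ω → *-mono-≤ (pos X ω) (pos Y ω) }

_∘ᵇ_ : ∀ {Ω Ω′ : Set} → Bound Ω → (Ω′ → Ω) → Bound Ω′
X ∘ᵇ g = record { at = at X ∘ g ; pos = pos X ∘ g }

infix 3 O[_]_
infix 3 _∶_⟶_∈O_

-- The constant `κ` comes before `ω`, so it is uniform over the family. Only steps are counted:
-- intermediate trees share subtrees, and the size is charged once, for the final output.
record _∶_⟶_∈O_ {Ω : Set} (P : Prog) (x y : Ω → Tree) (X : Bound Ω) : Set where
  constructor O[_]_
  field
    κ   : ℕ
    run : ∀ ω → ∃[ n ] (P ⊢ x ω ⇓ y ω [ n ]) × n ≤ κ * at X ω

private variable
  Ω Ω′      : Set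
  P Q R     : Prog
  x y z     : Ω → Tree
  X Y       : Bound Ω

raise : ∀ c → (∀ ω → at X ω ≤ c * at Y ω) → P ∶ x ⟶ y ∈O X → P ∶ x ⟶ y ∈O Y
raise {X = X} {Y = Y} c X≤cY (O[ κ ] run) = O[ κ * c ] λ ω → let n , d , n≤ = run ω in n , d , (begin
  n                ≤⟨ n≤ ⟩
  κ * at X ω       ≤⟨ *-monoʳ-≤ κ (X≤cY ω) ⟩
  κ * (c * at Y ω) ≡⟨ *-assoc κ c _ ⟨
  κ * c * at Y ω   ∎)
  where open ≤-Reasoning

raise₁ : (∀ ω → at X ω ≤ at Y ω) → P ∶ x ⟶ y ∈O X → P ∶ x ⟶ y ∈O Y
raise₁ X≤Y = raise 1 λ ω → ≤-trans (X≤Y ω) (≤-reflexive (sym (*-identityˡ _)))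

convert : ∀ {x x′ y y′ : Ω → Tree} → (∀ ω → x ω ≡ x′ ω) → (∀ ω → y ω ≡ y′ ω) →
          P ∶ x ⟶ y ∈O X → P ∶ x′ ⟶ y′ ∈O X
convert {P = P} {X = X} p q (O[ κ ] run) = O[ κ ] λ ω →
  let n , d , n≤ = run ω in
  n , subst (λ b → P ⊢ _ ⇓ b [ n ]) (q ω) (subst (λ a → P ⊢ a ⇓ _ [ n ]) (p ω) d) , n≤

pull : (g : Ω′ → Ω) → P ∶ x ⟶ y ∈O X → P ∶ x ∘ g ⟶ y ∘ g ∈O X ∘ᵇ g
pull g (O[ κ ] run) = O[ κ ] (run ∘ g)

suc-+-bound : ∀ {a b X} κ κ′ → 1 ≤ X → a ≤ κ * X → b ≤ κ′ * X → suc (a + b) ≤ suc (κ + κ′) * X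
suc-+-bound {X = X} κ κ′ 1≤X a≤ b≤ =
  +-mono-≤ 1≤X (≤-trans (+-mono-≤ a≤ b≤) (≤-reflexive (sym (*-distribʳ-+ X κ κ′))))

consᴼ : P ∶ x ⟶ y ∈O X → Q ∶ x ⟶ z ∈O X → cons P Q ∶ x ⟶ (λ ω → y ω ∙ z ω) ∈O X
consᴼ {X = X} (O[ κ ] p) (O[ κ′ ] q) = O[ suc (κ + κ′) ] λ ω →
  let a , d , a≤ = p ω
      b , e , b≤ = q ω
  in suc (a + b) , cons d e , suc-+-bound κ κ′ (pos X ω) a≤ b≤

infixr 4 _⨾ᴼ_

_⨾ᴼ_ : P ∶ x ⟶ y ∈O X → Q ∶ y ⟶ z ∈O X → P ⨾ Q ∶ x ⟶ z ∈O X
_⨾ᴼ_ {X = X} (O[ κ ] p) (O[ κ′ ] q) = O[ suc (κ + κ′) ] λ ω →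
  let a , d , a≤ = p ω
      b , e , b≤ = q ω
  in suc (a + b) , (d ⨾ e) , suc-+-bound κ κ′ (pos X ω) a≤ b≤

condᴼ : ∀ {b : Ω → Bool} {x y z : Ω → Tree} {X : Bound Ω} →
        P ∶ x ⟶ encBit ∘ b ∈O X → Q ∶ x ⟶ y ∈O X → R ∶ x ⟶ z ∈O X →
        cond P Q R ∶ x ⟶ (λ ω → if b ω then y ω else z ω) ∈O X
condᴼ {Ω} {P} {Q} {R} {b} {x} {y} {z} {X} (O[ κ₀ ] p) (O[ κ₁ ] q) (O[ κ₂ ] r) =
  O[ suc (κ₀ + (κ₁ + κ₂)) ] λ ω → branch ω (b ω) (p ω)
  where
  branch : ∀ ω c → (∃[ n ] (P ⊢ x ω ⇓ encBit c [ n ]) × n ≤ κ₀ * at X ω) →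
           ∃[ n ] (cond P Q R ⊢ x ω ⇓ (if c then y ω else z ω) [ n ]) ×
                  n ≤ suc (κ₀ + (κ₁ + κ₂)) * at X ω
  branch ω true (a , d , a≤) = let n , e , n≤ = q ω in
    suc (a + n) , cond-true d e , suc-+-bound κ₀ (κ₁ + κ₂) (pos X ω) a≤
      (≤-trans n≤ (*-monoˡ-≤ (at X ω) (m≤m+n κ₁ κ₂)))
  branch ω false (a , d , a≤) = let n , e , n≤ = r ω in
    suc (a + n) , cond-false d e , suc-+-bound κ₀ (κ₁ + κ₂) (pos X ω) a≤
      (≤-trans n≤ (*-monoˡ-≤ (at X ω) (m≤n+m κ₂ κ₁)))

-- Loop-free programs are evaluated by the type checker.

loopFree : Prog → Bool
loopFree (cons P Q)   = if loopFree P then loopFree Q else false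
loopFree (P ⨾ Q)      = if loopFree P then loopFree Q else false
loopFree (cond P Q R) = if loopFree P then (if loopFree Q then loopFree R else false) else false
loopFree (while _ _)  = false
loopFree _            = true

head tail : Tree → Tree
head nil     = nil
head (x ∙ _) = x
tail nil     = nil
tail (_ ∙ y) = y

eval : Prog → Tree → Tree
eval skip         x = x
eval const        x = nil
eval hd           x = head x
eval tl           x = tail x
eval (cons P Q)   x = eval P x ∙ eval Q x
eval (P ⨾ Q)      x = eval Q (eval P x)
eval (cond P Q R) x with eval P x
... | nil   = eval R x
... | _ ∙ _ = eval Q x
-- A dummy value, since `loopFree` excludes this case.
eval (while _ _)  x = x

-- The cost is a constant because `steps` depends on the program alone and charges both branches of
-- a `cond`. The result is `eval P ∘ x`, so rearrangements of known cells are checked by computation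
-- and need no proof.
straightᴼ : ∀ P {_ : T (loopFree P)} {x : Ω → Tree} {X : Bound Ω} → P ∶ x ⟶ eval P ∘ x ∈O X
straightᴼ P {lf} {x} {X} = O[ steps P ] λ ω → let n , d , n≤ = go P lf (x ω) in
  n , d , ≤-trans n≤ (≤-trans (≤-reflexive (sym (*-identityʳ _))) (*-monoʳ-≤ (steps P) (pos X ω)))
  where
  steps : Prog → ℕ
  steps (cons P Q)   = suc (steps P + steps Q)
  steps (P ⨾ Q)      = suc (steps P + steps Q)
  steps (cond P Q R) = suc (steps P + (steps Q + steps R))
  steps _            = 1

  go : ∀ P → T (loopFree P) → ∀ x → ∃[ n ] (P ⊢ x ⇓ eval P x [ n ]) × n ≤ steps P
  go skip  _ x       = 1 , skip , ≤-refl
  go const _ x       = 1 , const , ≤-refl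
  go hd    _ nil     = 1 , hd-nil , ≤-refl
  go hd    _ (_ ∙ _) = 1 , hd-∙ , ≤-refl
  go tl    _ nil     = 1 , tl-nil , ≤-refl
  go tl    _ (_ ∙ _) = 1 , tl-∙ , ≤-refl
  go (cons P Q) lf x with loopFree P in eq
  ... | true = let a , d , a≤ = go P (subst T (sym eq) tt) x
                   b , e , b≤ = go Q lf x
               in suc (a + b) , cons d e , s≤s (+-mono-≤ a≤ b≤)
  go (P ⨾ Q) lf x with loopFree P in eq
  ... | true = let a , d , a≤ = go P (subst T (sym eq) tt) x
                   b , e , b≤ = go Q lf (eval P x)
               in suc (a + b) , (d ⨾ e) , s≤s (+-mono-≤ a≤ b≤)
  go (cond P Q R) lf x with loopFree P in eqP | loopFree Q in eqQ
  ... | true | true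
    with eval P x | go P (subst T (sym eqP) tt) x
  ... | nil | a , d , a≤ = let b , e , b≤ = go R lf x in
    suc (a + b) , cond-false d e , s≤s (+-mono-≤ a≤ (≤-trans b≤ (m≤n+m _ (steps Q))))
  ... | _ ∙ _ | a , d , a≤ = let b , e , b≤ = go Q (subst T (sym eqQ) tt) x in
    suc (a + b) , cond-true d e , s≤s (+-mono-≤ a≤ (≤-trans b≤ (m≤m+n _ (steps R))))

-- Loops

-- The tree has the form list, state, environment. The remaining list is itself the loop condition,
-- as only `nil` is false; `F` sees the current element together with state and environment and
-- returns the new state.
loop : Prog → Prog
loop F = while hd (cons (hd ⨾ tl) (cons (cons (hd ⨾ hd) tl ⨾ F) (tl ⨾ tl))) ⨾ (tl ⨾ hd)

module _ {Ω : Set} {A : Ω → Set} where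

  -- The state depends on the elements still to come and on those already
  -- processed, the latter in reverse.  Φ bounds the time spent so far.
  loopᴼ : ∀ {F} (enc : ∀ ω → A ω → Tree) (ρ : Ω → Tree)
          (st : ∀ ω → List (A ω) → List (A ω) → Tree)
          (X : Bound (Σ[ ω ∈ Ω ] A ω × List (A ω) × List (A ω)))
          (Φ : Bound (Σ[ ω ∈ Ω ] List (A ω))) →
          (∀ ω a zs ys → at X (ω , a , zs , ys) + at Φ (ω , ys) ≤ at Φ (ω , a ∷ ys)) →
          F ∶ (λ (ω , a , zs , ys) → enc ω a ∙ (st ω (a ∷ zs) ys ∙ ρ ω))
            ⟶ (λ (ω , a , zs , ys) → st ω zs (a ∷ ys)) ∈O X →
          (zs : ∀ ω → List (A ω)) →
          loop F ∶ (λ ω → encList (map (enc ω) (zs ω)) ∙ (st ω (zs ω) [] ∙ ρ ω))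
                 ⟶ (λ ω → st ω [] (reverse (zs ω))) ∈O Φ ∘ᵇ (λ ω → ω , reverse (zs ω))
  loopᴼ {F} enc ρ st X Φ amortised (O[ κ ] run) zs = O[ 6 + K ] λ ω →
    let n , d , n≤ = go ω (zs ω) [] in
    suc (n + 3) , (d ⨾ (tl-∙ ⨾ hd-∙)) , (begin
      suc (n + 3)                        ≡⟨ cong suc (+-comm n 3) ⟩
      4 + n                              ≤⟨ +-monoʳ-≤ 4 (≤-trans (m≤m+n n _) n≤) ⟩
      6 + K * φ ω (reverse (zs ω))       ≤⟨ +-monoˡ-≤ (K * φ ω (reverse (zs ω))) (*-monoʳ-≤ 6 {1} (pos Φ (ω , reverse (zs ω)))) ⟩
      6 * φ ω (reverse (zs ω)) + K * φ ω (reverse (zs ω))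
                                         ≡⟨ *-distribʳ-+ (φ ω (reverse (zs ω))) 6 K ⟨
      (6 + K) * φ ω (reverse (zs ω))     ∎)
    where
    open ≤-Reasoning
    -- A round takes 16 steps besides those of `F`. The 6 in `6 + K` consists of 4 for the closing
    -- `tl ⨾ hd` and 2 for the last test.
    K = 16 + κ

    φ : ∀ ω → List (A ω) → ℕ
    φ ω ys = at Φ (ω , ys)

    -- Amortised analysis: `K * φ ω ys` accounts for the rounds already done, and the 2 is the
    -- failing test at the end.
    go : ∀ ω zs ys → ∃[ n ]
         (while hd (cons (hd ⨾ tl) (cons (cons (hd ⨾ hd) tl ⨾ F) (tl ⨾ tl)))
            ⊢ encList (map (enc ω) zs) ∙ (st ω zs ys ∙ ρ ω) ⇓ nil ∙ (st ω [] (zs ʳ++ ys) ∙ ρ ω) [ n ])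
         × n + K * φ ω ys ≤ 2 + K * φ ω (zs ʳ++ ys)
    go ω []       ys = 2 , while-stop hd-∙ , ≤-refl
    go ω (a ∷ zs) ys =
      let n , d , n≤ = run (ω , a , zs , ys)
          m , e , m≤ = go ω zs (a ∷ ys)
          ξ          = at X (ω , a , zs , ys)
      in 13 + (n + 3) + m , while-step hd-∙
               (cons (hd-∙ ⨾ tl-∙) (cons (cons (hd-∙ ⨾ hd-∙) tl-∙ ⨾ d) (tl-∙ ⨾ tl-∙))) e , (begin
        13 + (n + 3) + m + K * φ ω ys           ≡⟨ shuffle n m (K * φ ω ys) ⟩
        m + (16 + n + K * φ ω ys)               ≤⟨ +-monoʳ-≤ m (+-monoˡ-≤ (K * φ ω ys)
                                                     (+-mono-≤ (*-monoʳ-≤ 16 {1} (pos X (ω , a , zs , ys))) n≤)) ⟩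
        m + (16 * ξ + κ * ξ + K * φ ω ys)       ≡⟨ collect m ξ (φ ω ys) κ ⟩
        m + K * (ξ + φ ω ys)                    ≤⟨ +-monoʳ-≤ m (*-monoʳ-≤ K (amortised ω a zs ys)) ⟩
        m + K * φ ω (a ∷ ys)                    ≤⟨ m≤ ⟩
        2 + K * φ ω (zs ʳ++ (a ∷ ys))           ∎)
      where
      shuffle : ∀ n m p → 13 + (n + 3) + m + p ≡ m + (16 + n + p)
      shuffle = solve-∀
      collect : ∀ m ξ p κ → m + (16 * ξ + κ * ξ + (16 + κ) * p) ≡ m + (16 + κ) * (ξ + p)
      collect = solve-∀

revP : Prog
revP = cons skip (cons const const) ⨾ loop (cons hd (tl ⨾ hd))

-- A loop that conses its results reverses their order, so the list is reversed beforehand.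
foldrP : Prog → Prog
foldrP F = cons (hd ⨾ revP) tl ⨾ loop F

lengthᵇ : ∀ {A : Ω → Set} → Bound (Σ[ ω ∈ Ω ] List (A ω))
lengthᵇ = record { at = λ (ω , xs) → suc (length xs) ; pos = λ _ → s≤s z≤n }

revᴼ : ∀ {A : Ω → Set} (enc : ∀ ω → A ω → Tree) (xs : ∀ ω → List (A ω)) →
       revP ∶ (λ ω → encList (map (enc ω) (xs ω))) ⟶ (λ ω → encList (map (enc ω) (reverse (xs ω))))
            ∈O lengthᵇ ∘ᵇ (λ ω → ω , xs ω)
revᴼ enc xs = straightᴼ (cons skip (cons const const)) ⨾ᴼ
  raise₁ (λ ω → ≤-reflexive (cong suc (length-reverse (xs ω))))
    (loopᴼ enc (λ _ → nil) (λ ω _ ys → encList (map (enc ω) ys)) unit lengthᵇ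
      (λ _ _ _ _ → ≤-refl) (straightᴼ (cons hd (tl ⨾ hd))) xs)

module _ {Ω : Set} {A : Ω → Set} where

  foldrᴼ : ∀ {F} (enc : ∀ ω → A ω → Tree) (ρ : Ω → Tree)
           (st : ∀ ω → List (A ω) → List (A ω) → Tree)
           (X : Bound (Σ[ ω ∈ Ω ] A ω × List (A ω) × List (A ω)))
           (Φ : Bound (Σ[ ω ∈ Ω ] List (A ω))) →
           (∀ ω a zs ys → at X (ω , a , zs , ys) + at Φ (ω , ys) ≤ at Φ (ω , a ∷ ys)) →
           F ∶ (λ (ω , a , zs , ys) → enc ω a ∙ (st ω (a ∷ zs) ys ∙ ρ ω))
             ⟶ (λ (ω , a , zs , ys) → st ω zs (a ∷ ys)) ∈O X →
           (xs : ∀ ω → List (A ω)) →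
           foldrP F ∶ (λ ω → encList (map (enc ω) (xs ω)) ∙ (st ω (reverse (xs ω)) [] ∙ ρ ω))
                    ⟶ (λ ω → st ω [] (xs ω)) ∈O Φ ∘ᵇ (λ ω → ω , xs ω)
  foldrᴼ enc ρ st X Φ amortised body xs =
    consᴼ (straightᴼ hd ⨾ᴼ raise₁ (λ ω → length<Φ ω (xs ω)) (revᴼ enc xs)) (straightᴼ tl) ⨾ᴼ
    convert (λ _ → refl) (λ ω → cong (st ω []) (reverse-involutive (xs ω)))
      (raise₁ (λ ω → ≤-reflexive (cong (λ ys → at Φ (ω , ys)) (reverse-involutive (xs ω))))
        (loopᴼ enc ρ st X Φ amortised body (λ ω → reverse (xs ω))))
    where
    -- Each round costs at least 1, so `Φ` also pays for reversing the list.
    length<Φ : ∀ ω ys → suc (length ys) ≤ at Φ (ω , ys)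
    length<Φ ω []       = pos Φ (ω , [])
    length<Φ ω (a ∷ ys) = ≤-trans
      (+-mono-≤ (pos X (ω , a , [] , ys)) (length<Φ ω ys)) (amortised ω a [] ys)

  -- The case of one bound for all rounds. The general `Φ` serves `bitsᴼ` and `tuplesᴼ`, where the
  -- state grows from round to round.
  foldr-uniformᴼ : ∀ {F} (enc : ∀ ω → A ω → Tree) (ρ : Ω → Tree)
           (st : ∀ ω → List (A ω) → List (A ω) → Tree) (L X : Bound Ω) →
           F ∶ (λ (ω , a , zs , ys) → enc ω a ∙ (st ω (a ∷ zs) ys ∙ ρ ω))
             ⟶ (λ (ω , a , zs , ys) → st ω zs (a ∷ ys)) ∈O X ∘ᵇ proj₁ →
           (xs : ∀ ω → List (A ω)) → (∀ ω → length (xs ω) ≤ at L ω) →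
           foldrP F ∶ (λ ω → encList (map (enc ω) (xs ω)) ∙ (st ω (reverse (xs ω)) [] ∙ ρ ω))
                    ⟶ (λ ω → st ω [] (xs ω)) ∈O L ⊗ X
  foldr-uniformᴼ enc ρ st L X body xs len≤ =
    raise 2 (λ ω → begin
      suc (length (xs ω)) * at X ω   ≤⟨ *-monoˡ-≤ (at X ω) (+-mono-≤ (pos L ω) (len≤ ω)) ⟩
      (at L ω + at L ω) * at X ω     ≡⟨ double (at L ω) (at X ω) ⟩
      2 * (at L ω * at X ω)          ∎)
      (foldrᴼ enc ρ st (X ∘ᵇ proj₁) (lengthᵇ ⊗ X ∘ᵇ proj₁) (λ _ _ _ _ → ≤-refl) body xs)
    where
    open ≤-Reasoning
    double : ∀ l x → (l + l) * x ≡ 2 * (l * x)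
    double = solve-∀

-- Map, filter, append, zip and enumeration

mapP : Prog → Prog
mapP F = cons hd (cons const tl) ⨾ foldrP (cons (cons hd (tl ⨾ tl) ⨾ F) (tl ⨾ hd))

filterP : Prog → Prog
filterP B = cons hd (cons const tl) ⨾
            foldrP (cond (cons hd (tl ⨾ tl) ⨾ B) (cons hd (tl ⨾ hd)) (tl ⨾ hd))

module _ {Ω : Set} {A : Ω → Set} where

  -- The environment `ρ` reaches every call of `F` as a pointer, so its size does not enter the
  -- cost.
  mapᴼ : ∀ {F} (enc out : ∀ ω → A ω → Tree) (ρ : Ω → Tree) (L X : Bound Ω) →
         F ∶ (λ (ω , a) → enc ω a ∙ ρ ω) ⟶ (λ (ω , a) → out ω a) ∈O X ∘ᵇ proj₁ →
         (xs : ∀ ω → List (A ω)) → (∀ ω → length (xs ω) ≤ at L ω) →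
         mapP F ∶ (λ ω → encList (map (enc ω) (xs ω)) ∙ ρ ω)
                ⟶ (λ ω → encList (map (out ω) (xs ω))) ∈O L ⊗ X
  mapᴼ enc out ρ L X body xs len≤ =
    straightᴼ (cons hd (cons const tl)) ⨾ᴼ
    foldr-uniformᴼ enc ρ (λ ω _ ys → encList (map (out ω) ys)) L X
      (consᴼ (straightᴼ (cons hd (tl ⨾ tl)) ⨾ᴼ pull (λ (ω , a , _) → ω , a) body) (straightᴼ (tl ⨾ hd)))
      xs len≤

  filterᴼ : ∀ {B} (enc : ∀ ω → A ω → Tree) (b : ∀ ω → A ω → Bool) (ρ : Ω → Tree) (L X : Bound Ω) →
            B ∶ (λ (ω , a) → enc ω a ∙ ρ ω) ⟶ (λ (ω , a) → encBit (b ω a)) ∈O X ∘ᵇ proj₁ →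
            (xs : ∀ ω → List (A ω)) → (∀ ω → length (xs ω) ≤ at L ω) →
            filterP B ∶ (λ ω → encList (map (enc ω) (xs ω)) ∙ ρ ω)
                      ⟶ (λ ω → encList (map (enc ω) (filterᵇ (b ω) (xs ω)))) ∈O L ⊗ X
  filterᴼ enc b ρ L X body xs len≤ =
    straightᴼ (cons hd (cons const tl)) ⨾ᴼ
    foldr-uniformᴼ enc ρ (λ ω _ ys → encList (map (enc ω) (filterᵇ (b ω) ys))) L X
      (convert (λ _ → refl) (λ (ω , a , _ , ys) → commute ω a ys)
        (condᴼ (straightᴼ (cons hd (tl ⨾ tl)) ⨾ᴼ pull (λ (ω , a , _) → ω , a) body)
               (straightᴼ (cons hd (tl ⨾ hd))) (straightᴼ (tl ⨾ hd))))
      xs len≤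
    where
    commute : ∀ ω a ys →
      (if b ω a then enc ω a ∙ encList (map (enc ω) (filterᵇ (b ω) ys))
                else encList (map (enc ω) (filterᵇ (b ω) ys)))
      ≡ encList (map (enc ω) (filterᵇ (b ω) (a ∷ ys)))
    commute ω a ys with b ω a
    ... | false = refl
    ... | true  = refl

appendP : Prog
appendP = cons hd (cons tl const) ⨾ foldrP (cons hd (tl ⨾ hd))

-- Only the first list is traversed; the second is the initial state and stays shared. This matters
-- in `productᴼ`, where the second list is the whole product built so far.
appendᴼ : ∀ {A : Ω → Set} (enc : ∀ ω → A ω → Tree) (L : Bound Ω)
          (xs ys : ∀ ω → List (A ω)) → (∀ ω → length (xs ω) ≤ at L ω) →
          appendP ∶ (λ ω → encList (map (enc ω) (xs ω)) ∙ encList (map (enc ω) (ys ω)))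
                  ⟶ (λ ω → encList (map (enc ω) (xs ω ++ ys ω))) ∈O L
appendᴼ enc L xs ys len≤ =
  raise₁ (λ ω → ≤-reflexive (*-identityʳ (at L ω)))
    (straightᴼ (cons hd (cons tl const)) ⨾ᴼ
     foldr-uniformᴼ enc (λ _ → nil) (λ ω _ zs → encList (map (enc ω) (zs ++ ys ω))) L unit
       (straightᴼ (cons hd (tl ⨾ hd))) xs len≤)

-- The fold meets the first list from its end, so the second one is reversed as well and popped from
-- the state, one element per round.
zipP : Prog
zipP = cons hd (cons (cons (tl ⨾ revP) const) const) ⨾
       foldrP (cons (tl ⨾ hd ⨾ hd ⨾ tl) (cons (cons hd (tl ⨾ hd ⨾ hd ⨾ hd)) (tl ⨾ hd ⨾ tl))) ⨾ tl

-- Two encodings of one index list `xs` express that the lists have equal length.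
zipᴼ : ∀ {A : Ω → Set} (a b : ∀ ω → A ω → Tree) (L : Bound Ω)
       (xs : ∀ ω → List (A ω)) → (∀ ω → length (xs ω) ≤ at L ω) →
       zipP ∶ (λ ω → encList (map (a ω) (xs ω)) ∙ encList (map (b ω) (xs ω)))
            ⟶ (λ ω → encList (map (λ i → a ω i ∙ b ω i) (xs ω))) ∈O L
zipᴼ a b L xs len≤ =
  consᴼ (straightᴼ hd) (consᴼ (consᴼ (straightᴼ tl ⨾ᴼ
    raise 2 (λ ω → +-mono-≤ (pos L ω) (≤-trans (len≤ ω) (≤-reflexive (sym (+-identityʳ _))))) (revᴼ b xs))
    (straightᴼ const)) (straightᴼ const)) ⨾ᴼ
  raise₁ (λ ω → ≤-reflexive (*-identityʳ (at L ω)))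
    (foldr-uniformᴼ a (λ _ → nil)
      (λ ω zs ys → encList (map (b ω) zs) ∙ encList (map (λ i → a ω i ∙ b ω i) ys)) L unit
      (straightᴼ _) xs len≤) ⨾ᴼ
  straightᴼ tl

-- The counter starts at the length of the list, since folding begins at its end.
enumP : Prog
enumP = cons hd (cons (cons tl const) const) ⨾
        foldrP (cons (tl ⨾ hd ⨾ hd ⨾ tl) (cons (cons (tl ⨾ hd ⨾ hd ⨾ tl) hd) (tl ⨾ hd ⨾ tl))) ⨾ tl

enumerate : ∀ {A : Set} → (A → Tree) → ℕ → List A → List Tree
enumerate enc n []       = []
enumerate enc n (x ∷ xs) = (encUnary n ∙ enc x) ∷ enumerate enc (suc n) xs

enumᴼ : ∀ {A : Ω → Set} (enc : ∀ ω → A ω → Tree) (L : Bound Ω)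
        (xs : ∀ ω → List (A ω)) → (∀ ω → length (xs ω) ≤ at L ω) →
        enumP ∶ (λ ω → encList (map (enc ω) (xs ω)) ∙ encUnary (length (xs ω)))
              ⟶ (λ ω → encList (enumerate (enc ω) 0 (xs ω))) ∈O L
enumᴼ enc L xs len≤ =
  convert (λ ω → cong (λ n → encList (map (enc ω) (xs ω)) ∙ encUnary n) (length-reverse (xs ω))) (λ _ → refl)
    (straightᴼ (cons hd (cons (cons tl const) const)) ⨾ᴼ
     raise₁ (λ ω → ≤-reflexive (*-identityʳ (at L ω)))
       (foldr-uniformᴼ enc (λ _ → nil)
         (λ ω zs ys → encUnary (length zs) ∙ encList (enumerate (enc ω) (length zs) ys)) L unit
         (straightᴼ _) xs len≤) ⨾ᴼ
     straightᴼ tl)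

-- Bit strings and tuples of messages

infix 10 2^_

sucᵇ : (Ω → ℕ) → Bound Ω
sucᵇ n = record { at = λ ω → suc (n ω) ; pos = λ _ → s≤s z≤n }

2^_ : (Ω → ℕ) → Bound Ω
2^ n = record { at = λ ω → 2 ^ n ω ; pos = λ ω → m^n>0 2 (n ω) }

length-allBits : ∀ n → length (allBits n) ≡ 2 ^ n
length-allBits zero    = refl
length-allBits (suc n) = trans (length-++ (map (false ∷_) (allBits n)))
  (cong₂ _+_ (trans (length-map (false ∷_) (allBits n)) (length-allBits n))
             (trans (trans (length-map (true ∷_) (allBits n)) (length-allBits n)) (sym (+-identityʳ (2 ^ n)))))

length-allBits≢0 : ∀ n → NonZero (length (allBits n))
length-allBits≢0 n = >-nonZero (≤-trans (m^n>0 2 n) (≤-reflexive (sym (length-allBits n))))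

bitsP : Prog
bitsP = cons skip (cons (cons const const) const) ⨾ foldrP
  (cons (tl ⨾ mapP (cons const hd)) (tl ⨾ mapP (cons (cons const const) hd)) ⨾ appendP)

-- Doubling the list at each step sums to 2ⁿ, without a factor n.
bitsᴼ : (n : Ω → ℕ) → bitsP ∶ encUnary ∘ n ⟶ (λ ω → encList (map encBits (allBits (n ω)))) ∈O 2^ n
bitsᴼ {Ω} n =
  -- A unary number is the encoding of a list of `tt`, so recursion on it becomes a fold.
  convert (λ ω → cong encList (map-replicate (λ _ → nil) (n ω) tt))
          (λ ω → cong (λ i → encList (map encBits (allBits i))) (length-replicate (n ω)))
    (raise₁ (λ ω → ≤-reflexive (cong (2 ^_) (length-replicate (n ω))))
      (straightᴼ (cons skip (cons (cons const const) const)) ⨾ᴼ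
       foldrᴼ (λ _ _ → nil) (λ _ → nil) (λ _ _ ys → encList (map encBits (allBits (length ys))))
         (2^ level) (2^ (length ∘ proj₂))
         (λ ω a zs ys → ≤-reflexive (cong (2 ^ length ys +_) (sym (+-identityʳ (2 ^ length ys)))))
         (consᴼ (straightᴼ tl ⨾ᴼ prepend false (cons const hd) (straightᴼ (cons const hd)))
                (straightᴼ tl ⨾ᴼ prepend true (cons (cons const const) hd) (straightᴼ (cons (cons const const) hd))) ⨾ᴼ
          appendᴼ (λ _ → encBits) (2^ level)
            (map (false ∷_) ∘ allBits ∘ level) (map (true ∷_) ∘ allBits ∘ level)
            λ ω → ≤-reflexive (trans (length-map (false ∷_) (allBits (level ω))) (length-allBits (level ω))))
         (λ ω → replicate (n ω) tt)))
  where
  Step : Set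
  Step = Σ[ ω ∈ Ω ] ⊤ × List ⊤ × List ⊤

  level : Step → ℕ
  level (_ , _ , _ , ys) = length ys

  prepend : ∀ b F → F ∶ (λ (ω , v) → encBits v ∙ nil) ⟶ (λ (ω , v) → encBits (b ∷ v)) ∈O unit →
            mapP F ∶ (λ ω → encList (map encBits (allBits (level ω))) ∙ nil)
                   ⟶ (λ ω → encList (map encBits (map (b ∷_) (allBits (level ω))))) ∈O 2^ level
  prepend b F body =
    convert (λ _ → refl) (λ ω → cong encList (map-∘ {g = encBits} {f = b ∷_} (allBits (level ω))))
      (raise₁ (λ ω → ≤-reflexive (*-identityʳ _))
        (mapᴼ (λ _ → encBits) (λ _ v → encBits (b ∷ v)) (λ _ → nil) (2^ level) unit body
          (allBits ∘ level) (λ ω → ≤-reflexive (length-allBits (level ω)))))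

length-cartesianProductWith : ∀ {A B C : Set} (f : A → B → C) xs ys →
                              length (cartesianProductWith f xs ys) ≡ length xs * length ys
length-cartesianProductWith f []       ys = refl
length-cartesianProductWith f (x ∷ xs) ys =
  trans (length-++ (map (f x) ys))
        (cong₂ _+_ (length-map (f x) ys) (length-cartesianProductWith f xs ys))

productP : Prog
productP = cons hd (cons const tl) ⨾
           foldrP (cons (cons (tl ⨾ tl) hd ⨾ mapP (cons tl hd)) (tl ⨾ hd) ⨾ appendP)

-- The hypothesis on `f` says that the bare cell of two elements already encodes their combination,
-- as when a message is put in front of a tuple. Each new element then takes a constant number of
-- steps.
productᴼ : ∀ {A B C : Ω → Set} (encA : ∀ ω → A ω → Tree) (encB : ∀ ω → B ω → Tree)
           (encC : ∀ ω → C ω → Tree) (f : ∀ ω → A ω → B ω → C ω) →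
           (∀ ω a b → encA ω a ∙ encB ω b ≡ encC ω (f ω a b)) →
           (L M : Bound Ω) (xs : ∀ ω → List (A ω)) (ys : ∀ ω → List (B ω)) →
           (∀ ω → length (xs ω) ≤ at L ω) → (∀ ω → length (ys ω) ≤ at M ω) →
           productP ∶ (λ ω → encList (map (encA ω) (xs ω)) ∙ encList (map (encB ω) (ys ω)))
                    ⟶ (λ ω → encList (map (encC ω) (cartesianProductWith (f ω) (xs ω) (ys ω)))) ∈O L ⊗ M
productᴼ encA encB encC f enc-f L M xs ys xs≤ ys≤ =
  straightᴼ (cons hd (cons const tl)) ⨾ᴼ
  foldr-uniformᴼ encA (λ ω → encList (map (encB ω) (ys ω)))
    (λ ω _ zs → encList (map (encC ω) (cartesianProductWith (f ω) zs (ys ω)))) L M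
    (consᴼ (straightᴼ (cons (tl ⨾ tl) hd) ⨾ᴼ
            convert (λ _ → refl) (λ (ω , a , _) → cong encList
                (trans (map-cong (enc-f ω a) (ys ω)) (map-∘ {g = encC ω} {f = f ω a} (ys ω))))
              (raise₁ (λ _ → ≤-reflexive (*-identityʳ _))
                (mapᴼ (λ (ω , _) → encB ω) (λ (ω , a , _) b → encA ω a ∙ encB ω b) (λ (ω , a , _) → encA ω a)
                  (M ∘ᵇ proj₁) unit (straightᴼ (cons tl hd)) (ys ∘ proj₁) (ys≤ ∘ proj₁))))
           (straightᴼ (tl ⨾ hd)) ⨾ᴼ
     appendᴼ (encC ∘ proj₁) (M ∘ᵇ proj₁)
       (λ (ω , a , _) → map (f ω a) (ys ω)) (λ (ω , _ , _ , zs) → cartesianProductWith (f ω) zs (ys ω))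
       λ (ω , a , _) → ≤-trans (≤-reflexive (length-map (f ω a) (ys ω))) (ys≤ ω))
    xs xs≤

encTuple : ∀ {ℓ k} → Vec (Bits ℓ) k → Tree
encTuple z = encList (map encBits (toList z))

tuples : ∀ ℓ k → List (Vec (Bits ℓ) k)
tuples ℓ zero    = [] ∷ []
tuples ℓ (suc k) = cartesianProductWith _∷_ (allBits ℓ) (tuples ℓ k)

2^ℓ*suc : ∀ ℓ k → 2 ^ ℓ * 2 ^ (ℓ * k) ≡ 2 ^ (ℓ * suc k)
2^ℓ*suc ℓ k = trans (sym (^-distribˡ-+-* 2 ℓ (ℓ * k))) (cong (2 ^_) (sym (*-suc ℓ k)))

length-tuples : ∀ ℓ k → length (tuples ℓ k) ≡ 2 ^ (ℓ * k)
length-tuples ℓ zero    = cong (2 ^_) (sym (*-zeroʳ ℓ))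
length-tuples ℓ (suc k) = begin
  length (tuples ℓ (suc k))                     ≡⟨ length-cartesianProductWith _∷_ (allBits ℓ) (tuples ℓ k) ⟩
  length (allBits ℓ) * length (tuples ℓ k)      ≡⟨ cong₂ _*_ (length-allBits ℓ) (length-tuples ℓ k) ⟩
  2 ^ ℓ * 2 ^ (ℓ * k)                           ≡⟨ 2^ℓ*suc ℓ k ⟩
  2 ^ (ℓ * suc k)                               ∎
  where open Relation.Binary.PropositionalEquality.≡-Reasoning

-- The 2^ℓ messages are enumerated anew for each coordinate: this way they
-- are never enumerated if k = 0, when 2^ℓ may exceed 2^(ℓ k).
tuplesP : Prog
tuplesP = cons hd (cons (cons const const) tl) ⨾ foldrP (cons (tl ⨾ tl ⨾ bitsP) (tl ⨾ hd) ⨾ productP)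

-- For `ℓ = 0` the levels do not grow and their costs do not sum geometrically. Hence each level is
-- bounded by the last one, at the price of a factor `k + 1` that the final bound contains anyway.
tuplesᴼ : (ℓ k : Ω → ℕ) →
          tuplesP ∶ (λ ω → encUnary (k ω) ∙ encUnary (ℓ ω))
                  ⟶ (λ ω → encList (map encTuple (tuples (ℓ ω) (k ω))))
                  ∈O 2^ (λ ω → ℓ ω * k ω) ⊗ sucᵇ k
tuplesᴼ {Ω} ℓ k =
  convert (λ ω → cong (λ t → encList t ∙ encUnary (ℓ ω)) (map-replicate (λ _ → nil) (k ω) tt))
          (λ ω → cong (λ i → encList (map encTuple (tuples (ℓ ω) i))) (length-replicate (k ω)))
    (raise₁ (λ ω → ≤-reflexive (cong (λ i → 2 ^ (ℓ ω * i) * suc i) (length-replicate (k ω))))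
      (straightᴼ (cons hd (cons (cons const const) tl)) ⨾ᴼ
       foldrᴼ (λ _ _ → nil) (encUnary ∘ ℓ) (λ ω _ ys → encList (map encTuple (tuples (ℓ ω) (length ys))))
         (2^ (λ (ω , a , _ , ys) → ℓ ω * length (a ∷ ys)))
         (2^ (λ (ω , ys) → ℓ ω * length ys) ⊗ sucᵇ (length ∘ proj₂))
         amortised
         (consᴼ
           (straightᴼ tl ⨾ᴼ straightᴼ tl ⨾ᴼ
            raise₁ (λ (ω , _ , _ , ys) → ^-monoʳ-≤ 2 (m≤m*n (ℓ ω) (suc (length ys)))) (bitsᴼ (ℓ ∘ proj₁)))
           (straightᴼ (tl ⨾ hd)) ⨾ᴼ
          raise₁ (λ (ω , _ , _ , ys) → ≤-reflexive (2^ℓ*suc (ℓ ω) (length ys)))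
            (productᴼ (λ _ → encBits) (λ _ → encTuple) (λ _ → encTuple) (λ _ → _∷_) (λ _ _ _ → refl)
              (2^ (ℓ ∘ proj₁)) (2^ (λ (ω , _ , _ , ys) → ℓ ω * length ys))
              (λ (ω , _) → allBits (ℓ ω)) (λ (ω , _ , _ , ys) → tuples (ℓ ω) (length ys))
              (λ (ω , _) → ≤-reflexive (length-allBits (ℓ ω)))
              (λ (ω , _ , _ , ys) → ≤-reflexive (length-tuples (ℓ ω) (length ys)))))
         (λ ω → replicate (k ω) tt)))
  where
  open ≤-Reasoning
  amortised : ∀ ω (a : ⊤) (zs ys : List ⊤) →
    2 ^ (ℓ ω * suc (length ys)) + 2 ^ (ℓ ω * length ys) * suc (length ys)
    ≤ 2 ^ (ℓ ω * suc (length ys)) * suc (suc (length ys))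
  amortised ω _ _ ys = let n = length ys in begin
    2 ^ (ℓ ω * suc n) + 2 ^ (ℓ ω * n) * suc n      ≤⟨ +-monoʳ-≤ (2 ^ (ℓ ω * suc n)) (*-monoˡ-≤ (suc n)
                                                        (^-monoʳ-≤ 2 (*-monoʳ-≤ (ℓ ω) (n≤1+n n)))) ⟩
    2 ^ (ℓ ω * suc n) + 2 ^ (ℓ ω * suc n) * suc n  ≡⟨ *-suc (2 ^ (ℓ ω * suc n)) (suc n) ⟨
    2 ^ (ℓ ω * suc n) * suc (suc n)                ∎

-- Comparing bit strings

agree : List (Bool × Bool) → Bool
agree []               = true
agree ((b , c) ∷ bits) = if b then (if c then agree bits else false) else (if c then false else agree bits)

sameBits : ∀ {n} → Bits n → Bits n → Bool
sameBits x y = agree (toList (zip x y))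

sameBits-refl : ∀ {n} (x : Bits n) → T (sameBits x x)
sameBits-refl []          = tt
sameBits-refl (false ∷ x) = sameBits-refl x
sameBits-refl (true  ∷ x) = sameBits-refl x

sameBits⇒≡ : ∀ {n} (x y : Bits n) → T (sameBits x y) → x ≡ y
sameBits⇒≡ []          []          _    = refl
sameBits⇒≡ (false ∷ x) (false ∷ y) same = cong (false ∷_) (sameBits⇒≡ x y same)
sameBits⇒≡ (true  ∷ x) (true  ∷ y) same = cong (true ∷_) (sameBits⇒≡ x y same)

sameBitsP : Prog
sameBitsP = zipP ⨾ cons skip (cons (cons const const) const) ⨾
            foldrP (cond (hd ⨾ hd) (cond (hd ⨾ tl) (tl ⨾ hd) const) (cond (hd ⨾ tl) const (tl ⨾ hd)))

-- The nested conditionals of `agree` mirror the program, so one round is verified by evaluation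
-- once both bits are known.
sameBitsᴼ : (n : Ω → ℕ) (x y : ∀ ω → Bits (n ω)) →
            sameBitsP ∶ (λ ω → encBits (x ω) ∙ encBits (y ω)) ⟶ (λ ω → encBit (sameBits (x ω) (y ω)))
                      ∈O sucᵇ n
sameBitsᴼ {Ω} n x y =
  convert (λ ω → cong₂ _∙_ (zip₁ (x ω) (y ω)) (zip₂ (x ω) (y ω))) (λ _ → refl)
    (zipᴼ (λ _ → encBit ∘ proj₁) (λ _ → encBit ∘ proj₂) (sucᵇ n) pairs short ⨾ᴼ
     straightᴼ (cons skip (cons (cons const const) const)) ⨾ᴼ
     raise₁ (λ ω → ≤-reflexive (*-identityʳ _))
       (foldr-uniformᴼ (λ _ (b , c) → encBit b ∙ encBit c) (λ _ → nil) (λ _ _ bits → encBit (agree bits))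
         (sucᵇ n) unit
         (convert (λ _ → refl) (λ (ω , (b , c) , _ , bits) → step b c bits)
           (straightᴼ (cond (hd ⨾ hd) (cond (hd ⨾ tl) (tl ⨾ hd) const) (cond (hd ⨾ tl) const (tl ⨾ hd)))))
         pairs short))
  where
  pairs : Ω → List (Bool × Bool)
  pairs ω = toList (zip (x ω) (y ω))

  short : ∀ ω → length (pairs ω) ≤ suc (n ω)
  short ω = ≤-trans (≤-reflexive (length-toList (zip (x ω) (y ω)))) (n≤1+n (n ω))

  zip₁ : ∀ {n} (x y : Bits n) → encList (map (encBit ∘ proj₁) (toList (zip x y))) ≡ encBits x
  zip₁ []      []      = refl
  zip₁ (b ∷ x) (c ∷ y) = cong (encBit b ∙_) (zip₁ x y)

  zip₂ : ∀ {n} (x y : Bits n) → encList (map (encBit ∘ proj₂) (toList (zip x y))) ≡ encBits y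
  zip₂ []      []      = refl
  zip₂ (b ∷ x) (c ∷ y) = cong (encBit c ∙_) (zip₂ x y)

  step : ∀ b c bits →
    eval (cond (hd ⨾ hd) (cond (hd ⨾ tl) (tl ⨾ hd) const) (cond (hd ⨾ tl) const (tl ⨾ hd)))
         ((encBit b ∙ encBit c) ∙ (encBit (agree bits) ∙ nil))
    ≡ encBit (agree ((b , c) ∷ bits))
  step false false bits = refl
  step false true  bits = refl
  step true  false bits = refl
  step true  true  bits = refl

-- Label covers

-- `_/_` divides by the gcd, so the comparison is made between unnormalised rationals, where it is a
-- cross-multiplication.
fraction≤1 : ∀ a n .{{_ : NonZero n}} → a ≤ n → ℤ.+ a / n ℚ.≤ 1ℚ
fraction≤1 a (suc d) a≤n = ℚ.toℚᵘ-cancel-≤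
  (ℚᵘ.≤-respˡ-≃ (ℚᵘ.≃-sym (ℚ.toℚᵘ-fromℚᵘ (mkℚᵘ (ℤ.+ a) d)))
    (*≤* (subst₂ ℤ._≤_ (sym (ℤ.*-identityʳ (ℤ.+ a))) (sym (ℤ.*-identityˡ (ℤ.+ suc d))) (ℤ.+≤+ a≤n))))

fraction≡1 : ∀ n .{{_ : NonZero n}} → ℤ.+ n / n ≡ 1ℚ
fraction≡1 (suc d) = ℚ.fromℚᵘ-cong {mkℚᵘ (ℤ.+ suc d) d} {mkℚᵘ (ℤ.+ 1) 0} (*≡* (ℤ.*-comm (ℤ.+ suc d) (ℤ.+ 1)))

-- `_⊔_` returns one of its arguments, so any predicate passes to the maximum. One proof thus serves
-- both `≤ 1` and `≤ℝ s`, the latter being a bare predicate on rationals.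
maximum-preserves : ∀ {A : Set} (C : ℚ → Set) (g : A → ℚ) → C 0ℚ → (∀ x → C (g x)) →
                    ∀ xs → C (foldr _⊔_ 0ℚ (map g xs))
maximum-preserves C g c₀ c []       = c₀
maximum-preserves C g c₀ c (x ∷ xs) with ℚ.⊔-sel (g x) (foldr _⊔_ 0ℚ (map g xs))
... | inj₁ eq = subst C (sym eq) (c x)
... | inj₂ eq = subst C (sym eq) (maximum-preserves C g c₀ c xs)

≤-maximum : ∀ {A : Set} (g : A → ℚ) {x xs} → x ∈ xs → g x ℚ.≤ foldr _⊔_ 0ℚ (map g xs)
≤-maximum g {xs = y ∷ ys} (here refl) = ℚ.p≤p⊔q (g y) (foldr _⊔_ 0ℚ (map g ys))
≤-maximum g {xs = y ∷ ys} (there x∈)  = ℚ.≤-trans (≤-maximum g x∈) (ℚ.p≤q⊔p (g y) (foldr _⊔_ 0ℚ (map g ys)))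

-- This links the count over indices in `coveredFraction` with the count over coin strings in
-- `acceptanceProbability`.
length-filter-tabulate : ∀ {n} {A B : Set} {P : A → Set} {Q : B → Set}
  (P? : Decidable P) (Q? : Decidable Q) (g : Fin n → A) (h : Fin n → B) → (∀ i → P (g i) ⇔ Q (h i)) →
  length (filter P? (tabulate g)) ≡ length (filter Q? (tabulate h))
length-filter-tabulate {zero}  P? Q? g h P⇔Q = refl
length-filter-tabulate {suc n} P? Q? g h P⇔Q
  with P? (g zero) | Q? (h zero) | length-filter-tabulate P? Q? (g ∘ suc) (h ∘ suc) (P⇔Q ∘ suc)
... | yes p | yes q | eq = cong suc eq
... | no ¬p | no ¬q | eq = eq
... | yes p | no ¬q | eq = contradiction (Equivalence.to (P⇔Q zero) p) ¬q
... | no ¬p | yes q | eq = contradiction (Equivalence.from (P⇔Q zero) q) ¬p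

-- Without function extensionality, membership only holds up to pointwise equality.
allChoices-complete : ∀ {h} (n : Fin h → ℕ) (S : Choice n) →
                      ∃[ S′ ] S′ ∈ allChoices n × (∀ j → S′ j ≡ S j)
allChoices-complete {zero}  n S = _ , here refl , λ ()
allChoices-complete {suc h} n S =
  let S′ , S′∈ , S′≡S = allChoices-complete (n ∘ suc) (S ∘ suc) in
  _ , ∈-concatMap⁺ _ (lose (∈-allFin (S zero)) (∈-map⁺ _ S′∈)) ,
  λ { zero → refl ; (suc j) → S′≡S j }

∈-allBits : ∀ {n} (x : Bits n) → x ∈ allBits n
∈-allBits []                  = here refl
∈-allBits {suc n} (false ∷ x) = ∈-++⁺ˡ (∈-map⁺ (false ∷_) (∈-allBits x))
∈-allBits {suc n} (true  ∷ x) = ∈-++⁺ʳ (map (false ∷_) (allBits n)) (∈-map⁺ (true ∷_) (∈-allBits x))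

∈-tuples : ∀ {ℓ k} (z : Vec (Bits ℓ) k) → z ∈ tuples ℓ k
∈-tuples []      = here refl
∈-tuples (y ∷ z) = ∈-cartesianProductWith⁺ _∷_ (∈-allBits y) (∈-tuples z)

sum-tabulate≤ : ∀ {k} N (g : Fin k → ℕ) → (∀ j → g j ≤ N) → sum (tabulate g) ≤ N * k
sum-tabulate≤ {zero}  N g g≤ = z≤n
sum-tabulate≤ {suc k} N g g≤ = ≤-trans (+-mono-≤ (g≤ zero) (sum-tabulate≤ N (g ∘ suc) (g≤ ∘ suc)))
                                       (≤-reflexive (sym (*-suc N k)))

-- The reduction

map-lookup : ∀ {A B : Set} (g : A → B) xs → map g xs ≡ tabulate (g ∘ lookup xs)
map-lookup g xs = trans (cong (map g) (sym (tabulate-lookup xs))) (map-tabulate (lookup xs) g)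

map-allFin : ∀ {n} {A : Set} (g : Fin n → A) → map g (allFin n) ≡ tabulate g
map-allFin = map-tabulate id

toList-tabulate : ∀ {n} {A B : Set} (g : A → B) (xs : Vec A n) →
                  map g (toList xs) ≡ tabulate (g ∘ Vec.lookup xs)
toList-tabulate g []       = refl
toList-tabulate g (x ∷ xs) = cong (g x ∷_) (toList-tabulate g xs)

enumerate-tabulate : ∀ {n} {A : Set} (enc : A → Tree) i (xs : Vec A n) →
  enumerate enc i (toList xs) ≡ tabulate (λ j → encUnary (i + toℕ j) ∙ enc (Vec.lookup xs j))
enumerate-tabulate enc i []       = refl
enumerate-tabulate enc i (x ∷ xs) = cong₂ _∷_
  (cong (λ n → encUnary n ∙ enc x) (sym (+-identityʳ i)))
  (trans (enumerate-tabulate enc (suc i) xs)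
         (tabulate-cong λ j → cong (λ n → encUnary n ∙ enc (Vec.lookup xs j)) (sym (+-suc i (toℕ j)))))

n≤size-encBits : ∀ {n} (x : Bits n) → suc n ≤ size (encBits x)
n≤size-encBits []      = ≤-refl
n≤size-encBits (b ∷ x) = s≤s (≤-trans (n≤size-encBits x) (m≤n+m _ (size (encBit b))))

X≤L⊗X : (L X : Bound Ω) → ∀ ω → at X ω ≤ at (L ⊗ X) ω
X≤L⊗X L X ω = ≤-trans (≤-reflexive (sym (*-identityˡ _))) (*-monoˡ-≤ (at X ω) (pos L ω))

L≤L⊗X : (L X : Bound Ω) → ∀ ω → at L ω ≤ at (L ⊗ X) ω
L≤L⊗X L X ω = ≤-trans (≤-reflexive (sym (*-identityʳ _))) (*-monoʳ-≤ (at L ω) (pos X ω))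

encSubset : ∀ {n} → List (Bits n) → Tree
encSubset Aⱼ = encList (map encBits Aⱼ)

module Reduction (m : ℕ → ℕ → ℕ) (f : ∀ N k → Vec (Bits (m N k)) k → Bool)
                 (w r ℓ : ℕ → ℕ → ℕ) (s : ℕ → ℕ → ℝ)
                 (protocols : EfficientProtocols m f w r ℓ s) where

  open EfficientProtocols protocols

  -- The index set of the running time statements. It collects all `N`, `k` and instances, which
  -- makes the constants uniform in them.
  record Input : Set where
    constructor input
    field
      N k : ℕ
      I   : Instance (m N k) k N

    wᴵ rᴵ ℓᴵ mᴵ : ℕ
    wᴵ = w N k
    rᴵ = r N k
    ℓᴵ = ℓ N k
    mᴵ = m N k

    open Instance I public using (A; card≤N)
    open Protocol (protocol N k) public

    subset : Fin k → List (Bits mᴵ)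
    subset = Vec.lookup A

    accepted : Bits wᴵ → Bits rᴵ → List (Vec (Bits ℓᴵ) k)
    accepted μ γ = filterᵇ (referee μ γ) (tuples ℓᴵ k)

    agreesWith : Bits rᴵ → Vec (Bits ℓᴵ) k → (j : Fin k) → Bits mᴵ → Bool
    agreesWith γ z j x = sameBits (message j x γ) (Vec.lookup z j)

    -- `q` is the length of `allBits rᴵ`, which equals `2 ^ rᴵ` only propositionally, so that an
    -- index of a left super-node looks up its coin string without a cast.
    Γ : Bits wᴵ → LabelCover
    Γ μ = record
      { q        = length (allBits rᴵ)
      ; h        = k
      ; q≢0      = length-allBits≢0 rᴵ
      ; left     = λ i → length (accepted μ (lookup (allBits rᴵ) i))
      ; right    = length ∘ subset
      ; adjacent = λ i u j v →
          agreesWith (lookup (allBits rᴵ) i) (lookup (accepted μ (lookup (allBits rᴵ) i)) u) j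
                     (lookup (subset j) v)
      }

    row : Bits rᴵ → Vec (Bits ℓᴵ) k → Tree
    row γ z = encList (map (λ j → encList (map (encBit ∘ agreesWith γ z j) (subset j))) (allFin k))

    block : Bits wᴵ → Bits rᴵ → Tree
    block μ γ = encList (map (row γ) (accepted μ γ))

    sizes : Tree
    sizes = encList (map (λ Aⱼ → encList (map (λ _ → nil) Aⱼ)) (toList A))

    instanceTree : Bits wᴵ → Tree
    instanceTree μ = sizes ∙ encList (map (block μ) (allBits rᴵ))

    messageTree : Bits rᴵ → Fin k → Tree
    messageTree γ j = encList (map (λ x → encBits (message j x γ)) (subset j))

    numbered : Fin k → Tree
    numbered j = encUnary (toℕ j) ∙ encSubset (subset j)

    -- The programs map over lists while `encLabelCover` tabulates over `Fin`; the two agree because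
    -- `lookup` runs through a list in order.
    encΓ : ∀ μ → instanceTree μ ≡ encLabelCover (Γ μ)
    encΓ μ = cong₂ _∙_
      (cong encList (trans (toList-tabulate _ A) (tabulate-cong λ j → cong encList (map-nil (subset j)))))
      (cong encList (trans (map-lookup (block μ) (allBits rᴵ)) (tabulate-cong λ i →
        cong encList (trans (map-lookup (row _) (accepted μ _)) (tabulate-cong λ u →
          cong encList (trans (map-allFin _) (tabulate-cong λ j →
            cong encList (map-lookup _ (subset j)))))))))
      where
      map-nil : ∀ {B : Set} (xs : List B) → map (λ _ → nil) xs ≡ replicate (length xs) nil
      map-nil []       = refl
      map-nil (_ ∷ xs) = cong (nil ∷_) (map-nil xs)

  -- Programs of the reduction and their running time

  open Input

  -- Everything that depends on neither the advice nor the coins is computed once and then passed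
  -- along as a pointer. The subsets carry their player's number because `playerProg` expects it.
  environment : Input → Tree
  environment ι = params (N ι) (k ι) ∙ encList (map (numbered ι) (allFin (k ι))) ∙
                  encList (map encBits (allBits (rᴵ ι))) ∙ encList (map encTuple (tuples (ℓᴵ ι) (k ι))) ∙
                  encInstance (I ι)

  Advised Tossed : Set
  Advised = Σ[ ι ∈ Input ] Bits (wᴵ ι)
  Tossed  = Σ[ (ι , _) ∈ Advised ] Bits (rᴵ ι)

  environmentᵗ : Tossed → Tree
  environmentᵗ ((ι , μ) , γ) = encBits γ ∙ encBits μ ∙ environment ι

  inputᵗ : Tossed → Input
  inputᵗ = proj₁ ∘ proj₁

  accepted≤ : ∀ ι μ γ → length (accepted ι μ γ) ≤ 2 ^ (ℓᴵ ι * k ι)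
  accepted≤ ι μ γ = ≤-trans (length-filter (T? ∘ referee ι μ γ) (tuples (ℓᴵ ι) (k ι)))
                            (≤-reflexive (length-tuples (ℓᴵ ι) (k ι)))

  polyᵇ perPlayer perBlock perInstance total : Bound Input
  polyᵇ = record
    -- The successor gives positivity outright, whatever the coefficient in `time`.
    { at  = λ ι → poly (suc (proj₁ time) , proj₂ time) (mᴵ ι)
    ; pos = λ ι → ≤-trans (m^n>0 (suc (mᴵ ι)) (proj₂ time)) (m≤m+n _ _)
    }
  perPlayer   = sucᵇ N ⊗ polyᵇ
  perBlock    = 2^ (λ ι → ℓᴵ ι * k ι) ⊗ (sucᵇ k ⊗ perPlayer)
  perInstance = 2^ rᴵ ⊗ perBlock
  total       = 2^ wᴵ ⊗ perInstance

  poly≤ : ∀ ι → poly time (mᴵ ι) ≤ at polyᵇ ι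
  poly≤ ι = *-monoˡ-≤ (suc (mᴵ ι) ^ proj₂ time) (n≤1+n (proj₁ time))

  programᴼ : {x y : Ω → Tree} (ι : Ω → Input) →
             (∀ ω → Computes P (x ω) (y ω) (poly time (mᴵ (ι ω)))) → P ∶ x ⟶ y ∈O polyᵇ ∘ᵇ ι
  programᴼ ι computes = O[ 1 ] λ ω → let n , d , n≤ = computes ω in
    n , d , (begin
      n                        ≤⟨ m≤m+n n _ ⟩
      _                        ≤⟨ n≤ ⟩
      poly time (mᴵ (ι ω))     ≤⟨ poly≤ (ι ω) ⟩
      at polyᵇ (ι ω)           ≡⟨ *-identityˡ _ ⟨
      1 * at polyᵇ (ι ω)       ∎)
    where open ≤-Reasoning

  card≤1+N : ∀ ι j → length (subset ι j) ≤ suc (N ι)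
  card≤1+N ι j = ≤-trans (card≤N ι j) (n≤1+n (N ι))

  allFin≤ : ∀ ι → length (allFin (k ι)) ≤ suc (k ι)
  allFin≤ ι = ≤-trans (≤-reflexive (length-tabulate id)) (n≤1+n (k ι))

  messageP messagesP : Prog
  -- The incoming tree lists `x`, `j`, `γ`, `μ` and then the environment, headed by the parameters;
  -- the paths rearrange these into the argument list of `playerProg`.
  messageP  = cons (tl ⨾ tl ⨾ tl ⨾ tl ⨾ hd) (cons (tl ⨾ hd) (cons hd (cons (tl ⨾ tl ⨾ hd) const))) ⨾ playerProg
  messagesP = cons (tl ⨾ tl ⨾ tl ⨾ hd) skip ⨾ mapP (cons (hd ⨾ tl) (cons (hd ⨾ hd) tl) ⨾ mapP messageP)

  messagesᴼ : messagesP ∶ environmentᵗ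
                        ⟶ (λ ((ι , _) , γ) → encList (map (messageTree ι γ) (allFin (k ι))))
                        ∈O (sucᵇ k ⊗ perPlayer) ∘ᵇ inputᵗ
  messagesᴼ =
    straightᴼ (cons (tl ⨾ tl ⨾ tl ⨾ hd) skip) ⨾ᴼ
    mapᴼ (numbered ∘ inputᵗ) (λ ((ι , _) , γ) → messageTree ι γ) environmentᵗ
      (sucᵇ k ∘ᵇ inputᵗ) (perPlayer ∘ᵇ inputᵗ)
      (straightᴼ (cons (hd ⨾ tl) (cons (hd ⨾ hd) tl)) ⨾ᴼ
       mapᴼ (λ _ → encBits) (λ (((ι , _) , γ) , j) x → encBits (message ι j x γ))
         (λ (ω , j) → encUnary (toℕ j) ∙ environmentᵗ ω)
         (sucᵇ N ∘ᵇ inputᵗ ∘ᵇ proj₁) (polyᵇ ∘ᵇ inputᵗ ∘ᵇ proj₁)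
         (straightᴼ (cons (tl ⨾ tl ⨾ tl ⨾ tl ⨾ hd) (cons (tl ⨾ hd) (cons hd (cons (tl ⨾ tl ⨾ hd) const)))) ⨾ᴼ
          programᴼ (λ ((((ι , _) , _) , _) , _) → ι)
            λ ((((ι , _) , γ) , j) , x) → player-time (N ι) (k ι) j x γ)
         (λ (((ι , _) , _) , j) → subset ι j) (λ (((ι , _) , _) , j) → card≤1+N ι j))
      (allFin ∘ k ∘ inputᵗ) (allFin≤ ∘ inputᵗ)

  acceptsP acceptedP : Prog
  acceptsP  = cons (tl ⨾ tl ⨾ tl ⨾ hd) (cons (tl ⨾ tl ⨾ hd) (cons (tl ⨾ hd) (cons hd const))) ⨾ refereeProg
  acceptedP = cons (tl ⨾ tl ⨾ tl ⨾ tl ⨾ tl ⨾ hd) skip ⨾ filterP acceptsP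

  acceptedᴼ : acceptedP ∶ environmentᵗ ⟶ (λ ((ι , μ) , γ) → encList (map encTuple (accepted ι μ γ)))
                        ∈O (2^ (λ ι → ℓᴵ ι * k ι) ⊗ polyᵇ) ∘ᵇ inputᵗ
  acceptedᴼ =
    straightᴼ (cons (tl ⨾ tl ⨾ tl ⨾ tl ⨾ tl ⨾ hd) skip) ⨾ᴼ
    filterᴼ (λ _ → encTuple) (λ ((ι , μ) , γ) → referee ι μ γ) environmentᵗ
      (2^ (λ ι → ℓᴵ ι * k ι) ∘ᵇ inputᵗ) (polyᵇ ∘ᵇ inputᵗ)
      (straightᴼ (cons (tl ⨾ tl ⨾ tl ⨾ hd) (cons (tl ⨾ tl ⨾ hd) (cons (tl ⨾ hd) (cons hd const)))) ⨾ᴼ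
       programᴼ (λ (((ι , _) , _) , _) → ι)
         λ (((ι , μ) , γ) , z) → referee-time (N ι) (k ι) μ γ z)
      (λ ((ι , _) , _) → tuples (ℓᴵ ι) (k ι))
      (λ ((ι , _) , _) → ≤-reflexive (length-tuples (ℓᴵ ι) (k ι)))

  rowP : Prog
  rowP = cons tl hd ⨾ zipP ⨾ cons skip const ⨾ mapP (hd ⨾ mapP sameBitsP)

  -- Zipping pairs the list of player `j`'s messages with the `j`-th entry of `z`, which then acts
  -- as the environment of the inner map.
  rowᴼ : rowP ∶ (λ (((ι , μ) , γ) , z) → encTuple z ∙ encList (map (messageTree ι γ) (allFin (k ι))))
              ⟶ (λ (((ι , μ) , γ) , z) → row ι γ z)
              ∈O (sucᵇ k ⊗ perPlayer) ∘ᵇ (inputᵗ ∘ proj₁)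
  rowᴼ =
    straightᴼ (cons tl hd) ⨾ᴼ
    convert (λ (((ι , _) , γ) , z) → cong (encList (map (messageTree ι γ) (allFin (k ι))) ∙_)
                (cong encList (trans (map-allFin _) (sym (toList-tabulate encBits z)))))
            (λ _ → refl)
      (raise₁ (λ (((ι , _) , _) , _) → L≤L⊗X (sucᵇ k) perPlayer ι)
        (zipᴼ (λ (((ι , _) , γ) , _) → messageTree ι γ) (λ (_ , z) j → encBits (Vec.lookup z j))
          (sucᵇ k ∘ᵇ ι′) (allFin ∘ k ∘ ι′) (allFin≤ ∘ ι′))) ⨾ᴼ
    straightᴼ (cons skip const) ⨾ᴼ
    mapᴼ (λ (((ι , _) , γ) , z) j → messageTree ι γ j ∙ encBits (Vec.lookup z j))
         (λ (((ι , _) , γ) , z) j → encList (map (encBit ∘ agreesWith ι γ z j) (subset ι j)))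
         (λ _ → nil) (sucᵇ k ∘ᵇ ι′) (perPlayer ∘ᵇ ι′)
         (straightᴼ hd ⨾ᴼ
          mapᴼ (λ ((((ι , _) , γ) , _) , j) x → encBits (message ι j x γ))
               (λ ((((ι , _) , γ) , z) , j) → encBit ∘ agreesWith ι γ z j)
               (λ ((_ , z) , j) → encBits (Vec.lookup z j))
               (sucᵇ N ∘ᵇ ι′ ∘ᵇ proj₁) (polyᵇ ∘ᵇ ι′ ∘ᵇ proj₁)
               (raise₁ (λ (((((ι , _) , γ) , _) , j) , x) → message-length ι γ j x)
                 (sameBitsᴼ (λ (((((ι , _) , _) , _) , _) , _) → ℓᴵ ι)
                   (λ (((((ι , _) , γ) , _) , j) , x) → message ι j x γ)
                   (λ (((_ , z) , j) , _) → Vec.lookup z j)))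
               (λ ((((ι , _) , _) , _) , j) → subset ι j) (λ ((((ι , _) , _) , _) , j) → card≤1+N ι j))
         (allFin ∘ k ∘ ι′) (allFin≤ ∘ ι′)
    where
    ι′ : (Σ[ ((ι , _) , _) ∈ Tossed ] Vec (Bits (ℓᴵ ι)) (k ι)) → Input
    ι′ = inputᵗ ∘ proj₁

    -- A comparison takes time linear in `ℓ`. A written message has more than `ℓ` nodes, and these
    -- are charged to the player's polynomial time; `j` and `x` are at hand wherever a comparison
    -- occurs.
    message-length : ∀ ι γ j x → suc (ℓᴵ ι) ≤ at polyᵇ ι
    message-length ι γ j x = let n , _ , n+size≤ = player-time (N ι) (k ι) j x γ in
      ≤-trans (n≤size-encBits (message ι j x γ))
        (≤-trans (m≤n+m _ n) (≤-trans n+size≤ (poly≤ ι)))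

  blockP : Prog
  blockP = cons acceptedP messagesP ⨾ mapP rowP

  blockᴼ : blockP ∶ environmentᵗ ⟶ (λ ((ι , μ) , γ) → block ι μ γ) ∈O perBlock ∘ᵇ inputᵗ
  blockᴼ =
    consᴼ (raise₁ (λ ((ι , _) , _) → *-monoʳ-≤ (2 ^ (ℓᴵ ι * k ι))
                     (≤-trans (X≤L⊗X (sucᵇ N) polyᵇ ι) (X≤L⊗X (sucᵇ k) perPlayer ι))) acceptedᴼ)
          (raise₁ (λ ((ι , _) , _) → X≤L⊗X (2^ (λ ι → ℓᴵ ι * k ι)) (sucᵇ k ⊗ perPlayer) ι) messagesᴼ) ⨾ᴼ
    mapᴼ (λ _ → encTuple) (λ ((ι , _) , γ) → row ι γ)
      (λ ((ι , _) , γ) → encList (map (messageTree ι γ) (allFin (k ι))))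
      (2^ (λ ι → ℓᴵ ι * k ι) ∘ᵇ inputᵗ) ((sucᵇ k ⊗ perPlayer) ∘ᵇ inputᵗ)
      rowᴼ (λ ((ι , μ) , γ) → accepted ι μ γ) (λ ((ι , μ) , γ) → accepted≤ ι μ γ)

  labelCoverP : Prog
  -- Overwriting every element of a subset by `nil` leaves its cardinality in unary.
  labelCoverP = cons (cons (tl ⨾ tl ⨾ tl ⨾ tl ⨾ tl) const ⨾ mapP (mapP const))
                     (cons (tl ⨾ tl ⨾ tl ⨾ hd) skip ⨾ mapP blockP)

  labelCoverᴼ : labelCoverP ∶ (λ (ι , μ) → encBits μ ∙ environment ι) ⟶ (λ (ι , μ) → instanceTree ι μ)
                            ∈O perInstance ∘ᵇ proj₁
  labelCoverᴼ = consᴼ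
    (straightᴼ (cons (tl ⨾ tl ⨾ tl ⨾ tl ⨾ tl) const) ⨾ᴼ
     raise₁ (λ (ι , _) → ≤-trans (*-monoʳ-≤ (suc (k ι)) (*-monoʳ-≤ (suc (N ι)) (pos polyᵇ ι))) (players≤ ι))
       (convert (λ _ → refl)
          (λ (ι , _) → cong encList (trans (map-allFin _) (sym (toList-tabulate _ (A ι)))))
          (convert (λ (ι , _) → cong (λ t → encList t ∙ nil) (trans (map-allFin _) (sym (toList-tabulate _ (A ι)))))
            (λ _ → refl)
            (mapᴼ (λ (ι , _) → encSubset ∘ subset ι)
              (λ (ι , _) → encList ∘ map (λ _ → nil) ∘ subset ι) (λ _ → nil)
              (sucᵇ k ∘ᵇ proj₁) ((sucᵇ N ⊗ unit) ∘ᵇ proj₁)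
              (mapᴼ (λ _ → encBits) (λ _ _ → nil) (λ _ → nil)
                (sucᵇ N ∘ᵇ proj₁ ∘ᵇ proj₁) unit (straightᴼ const)
                (λ ((ι , _) , j) → subset ι j) (λ ((ι , _) , j) → card≤1+N ι j))
              (allFin ∘ k ∘ proj₁) (allFin≤ ∘ proj₁)))))
    (straightᴼ (cons (tl ⨾ tl ⨾ tl ⨾ hd) skip) ⨾ᴼ
     mapᴼ (λ _ → encBits) (λ (ι , μ) → block ι μ) (λ (ι , μ) → encBits μ ∙ environment ι)
       (2^ rᴵ ∘ᵇ proj₁) (perBlock ∘ᵇ proj₁) blockᴼ
       (λ (ι , _) → allBits (rᴵ ι)) (λ (ι , _) → ≤-reflexive (length-allBits (rᴵ ι))))
    where
    players≤ : ∀ ι → at (sucᵇ k ⊗ perPlayer) ι ≤ at perInstance ι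
    players≤ ι = ≤-trans (X≤L⊗X (2^ (λ ι → ℓᴵ ι * k ι)) (sucᵇ k ⊗ perPlayer) ι) (X≤L⊗X (2^ rᴵ) perBlock ι)

  environmentP reductionP : Prog
  environmentP =
    cons hd
      (cons (cons (tl ⨾ hd) (hd ⨾ tl ⨾ hd) ⨾ enumP)
        (cons ((hd ⨾ tl ⨾ tl ⨾ tl ⨾ tl ⨾ hd) ⨾ bitsP)
          (cons (cons (hd ⨾ tl ⨾ hd) (hd ⨾ tl ⨾ tl ⨾ tl ⨾ tl ⨾ tl ⨾ hd) ⨾ tuplesP)
            (tl ⨾ hd))))
  reductionP = cons ((hd ⨾ tl ⨾ tl ⨾ tl ⨾ hd) ⨾ bitsP) environmentP ⨾ mapP labelCoverP

  inputTree outputTree : Input → Tree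
  inputTree  ι = params (N ι) (k ι) ∙ encInstance (I ι) ∙ nil
  outputTree ι = encList (map (instanceTree ι) (allBits (wᴵ ι)))

  environmentᴼ : environmentP ∶ inputTree ⟶ environment ∈O perInstance
  environmentᴼ =
    consᴼ (straightᴼ hd)
      (consᴼ (straightᴼ (cons (tl ⨾ hd) (hd ⨾ tl ⨾ hd)) ⨾ᴼ
              convert (λ ι → cong (λ n → encInstance (I ι) ∙ encUnary n) (length-toList (A ι)))
                      (λ ι → cong encList (trans (enumerate-tabulate encSubset 0 (A ι)) (sym (map-allFin _))))
                (raise₁ (λ ι → ≤-trans (L≤L⊗X (sucᵇ k) perPlayer ι)
                           (≤-trans (X≤L⊗X tuplesᵇ (sucᵇ k ⊗ perPlayer) ι) (X≤L⊗X (2^ rᴵ) perBlock ι)))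
                  (enumᴼ (λ _ → encSubset) (sucᵇ k) (toList ∘ A)
                    λ ι → ≤-trans (≤-reflexive (length-toList (A ι))) (n≤1+n (k ι)))))
        (consᴼ (straightᴼ (hd ⨾ tl ⨾ tl ⨾ tl ⨾ tl ⨾ hd) ⨾ᴼ raise₁ (L≤L⊗X (2^ rᴵ) perBlock) (bitsᴼ rᴵ))
          (consᴼ (straightᴼ (cons (hd ⨾ tl ⨾ hd) (hd ⨾ tl ⨾ tl ⨾ tl ⨾ tl ⨾ tl ⨾ hd)) ⨾ᴼ
                  raise₁ (λ ι → ≤-trans (*-monoʳ-≤ (at tuplesᵇ ι) (L≤L⊗X (sucᵇ k) perPlayer ι))
                                        (X≤L⊗X (2^ rᴵ) perBlock ι))
                    (tuplesᴼ ℓᴵ k))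
            (straightᴼ (tl ⨾ hd)))))
    where
    tuplesᵇ : Bound Input
    tuplesᵇ = 2^ (λ ι → ℓᴵ ι * k ι)

  reductionᴼ : reductionP ∶ inputTree ⟶ outputTree ∈O total
  reductionᴼ =
    consᴼ (straightᴼ (hd ⨾ tl ⨾ tl ⨾ tl ⨾ hd) ⨾ᴼ raise₁ (L≤L⊗X (2^ wᴵ) perInstance) (bitsᴼ wᴵ))
          (raise₁ (X≤L⊗X (2^ wᴵ) perInstance) environmentᴼ) ⨾ᴼ
    mapᴼ (λ _ → encBits) instanceTree environment (2^ wᴵ) perInstance labelCoverᴼ
      (allBits ∘ wᴵ) (λ ι → ≤-reflexive (length-allBits (wᴵ ι)))

  -- Size of the output

  size-encList : ∀ {A : Set} (g : A → Tree) c {L X} xs → 1 ≤ L → 1 ≤ X → length xs ≤ L →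
                 (∀ x → size (g x) ≤ c * X) → size (encList (map g xs)) ≤ (2 + c) * (L * X)
  size-encList g c {L} {X} xs 1≤L 1≤X len≤ size≤ = begin
    size (encList (map g xs))                  ≤⟨ go xs ⟩
    suc (length xs * suc (c * X))              ≤⟨ s≤s (*-monoˡ-≤ (suc (c * X)) len≤) ⟩
    suc (L * suc (c * X))                      ≡⟨ cong suc (*-suc L (c * X)) ⟩
    1 + (L + L * (c * X))                      ≤⟨ +-mono-≤ (*-mono-≤ 1≤L 1≤X)
                                                    (+-monoˡ-≤ (L * (c * X)) (≤-trans (≤-reflexive (sym (*-identityʳ L))) (*-monoʳ-≤ L 1≤X))) ⟩
    L * X + (L * X + L * (c * X))              ≡⟨ regroup L X c ⟩
    (2 + c) * (L * X)                          ∎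
    where
    open ≤-Reasoning
    regroup : ∀ L X c → L * X + (L * X + L * (c * X)) ≡ (2 + c) * (L * X)
    regroup = solve-∀

    go : ∀ xs → size (encList (map g xs)) ≤ suc (length xs * suc (c * X))
    go []       = ≤-refl
    go (x ∷ xs) = s≤s (≤-trans (+-mono-≤ (size≤ x) (go xs)) (≤-reflexive (+-suc (c * X) _)))

  -- Each level of lists adds 2 to the constant, for its cells and its closing `nil`. Starting from
  -- 3 for a bit, the four levels of adjacency data give 11; with 6 for the sizes and 1 for the root
  -- this is 18, and the list over all advice strings makes it 20.
  size-outputTree : ∀ ι → size (outputTree ι) ≤ 20 * at total ι
  size-outputTree ι =
    size-encList (instanceTree ι) 18 (allBits (wᴵ ι)) (pos (2^ wᴵ) ι) (pos perInstance ι)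
      (≤-reflexive (length-allBits (wᴵ ι)))
      λ μ → begin
        suc (size (sizes ι) + size (encList (map (block ι μ) (allBits (rᴵ ι)))))
          ≤⟨ +-mono-≤ (pos perInstance ι) (+-mono-≤ size-sizes (size-blocks μ)) ⟩
        at perInstance ι + (6 * at perInstance ι + 11 * at perInstance ι)
          ≡⟨ cong (at perInstance ι +_) (*-distribʳ-+ (at perInstance ι) 6 11) ⟨
        18 * at perInstance ι ∎
    where
    open ≤-Reasoning
    P₀ = at (sucᵇ k ⊗ perPlayer) ι

    size-bit : ∀ b → size (encBit b) ≤ 3
    size-bit false = s≤s z≤n
    size-bit true  = ≤-refl

    size-bit′ : ∀ b → size (encBit b) ≤ 3 * at polyᵇ ι
    size-bit′ b = ≤-trans (size-bit b) (*-monoʳ-≤ 3 {1} (pos polyᵇ ι))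

    size-row : ∀ γ z → size (row ι γ z) ≤ 7 * P₀
    size-row γ z = size-encList _ 5 (allFin (k ι)) (s≤s z≤n) (pos perPlayer ι) (allFin≤ ι) λ j →
      size-encList _ 3 (subset ι j) (s≤s z≤n) (pos polyᵇ ι) (card≤1+N ι j) λ x → size-bit′ (agreesWith ι γ z j x)

    size-blocks : ∀ μ → size (encList (map (block ι μ) (allBits (rᴵ ι)))) ≤ 11 * at perInstance ι
    size-blocks μ = size-encList _ 9 (allBits (rᴵ ι)) (pos (2^ rᴵ) ι) (pos perBlock ι)
      (≤-reflexive (length-allBits (rᴵ ι))) λ γ →
      size-encList _ 7 (accepted ι μ γ) (pos (2^ (λ ι → ℓᴵ ι * k ι)) ι) (pos (sucᵇ k ⊗ perPlayer) ι)
        (accepted≤ ι μ γ) (size-row γ)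

    size-sizes : size (sizes ι) ≤ 6 * at perInstance ι
    size-sizes = begin
      size (sizes ι)        ≡⟨ cong (size ∘ encList) (trans (toList-tabulate _ (A ι)) (sym (map-allFin _))) ⟩
      size (encList (map (λ j → encList (map (λ _ → nil) (subset ι j))) (allFin (k ι))))
        ≤⟨ size-encList _ 3 (allFin (k ι)) (s≤s z≤n) (pos perPlayer ι) (allFin≤ ι) (λ j →
             size-encList _ 1 (subset ι j) (s≤s z≤n) (pos polyᵇ ι) (card≤1+N ι j) λ _ →
               ≤-trans (pos polyᵇ ι) (≤-reflexive (sym (*-identityˡ _)))) ⟩
      5 * P₀                ≤⟨ *-mono-≤ (n≤1+n 5) (≤-trans (X≤L⊗X (2^ (λ ι → ℓᴵ ι * k ι)) (sucᵇ k ⊗ perPlayer) ι)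
                                              (X≤L⊗X (2^ rᴵ) perBlock ι)) ⟩
      6 * at perInstance ι  ∎

  reduction-time : ℕ × ℕ
  reduction-time = (_∶_⟶_∈O_.κ reductionᴼ + 20) * suc (proj₁ time) , proj₂ time

  reduction-computes : ∀ ι →
    Computes reductionP (inputTree ι) (encList (map (λ μ → encLabelCover (Γ ι μ)) (allBits (wᴵ ι))))
      (2 ^ (wᴵ ι + rᴵ ι + ℓᴵ ι * k ι) * (suc (N ι) * suc (k ι)) * poly reduction-time (mᴵ ι))
  reduction-computes ι =
    subst (λ t → Computes reductionP (inputTree ι) t
        (2 ^ (wᴵ ι + rᴵ ι + ℓᴵ ι * k ι) * (suc (N ι) * suc (k ι)) * poly reduction-time (mᴵ ι)))
      (cong encList (map-cong (encΓ ι) (allBits (wᴵ ι))))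
      (let n , d , n≤ = _∶_⟶_∈O_.run reductionᴼ ι in n , d , (begin
        n + size (outputTree ι)              ≤⟨ +-mono-≤ n≤ (size-outputTree ι) ⟩
        K * at total ι + 20 * at total ι     ≡⟨ *-distribʳ-+ (at total ι) K 20 ⟨
        (K + 20) * at total ι                ≡⟨ regroup (2 ^ wᴵ ι) (2 ^ rᴵ ι) (2 ^ (ℓᴵ ι * k ι)) (suc (k ι)) (suc (N ι))
                                                  (suc (proj₁ time)) (suc (mᴵ ι) ^ proj₂ time) (K + 20) ⟩
        2 ^ wᴵ ι * 2 ^ rᴵ ι * 2 ^ (ℓᴵ ι * k ι) * (suc (N ι) * suc (k ι)) * poly reduction-time (mᴵ ι)
          ≡⟨ cong (λ e → e * (suc (N ι) * suc (k ι)) * poly reduction-time (mᴵ ι))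
               (trans (^-distribˡ-+-* 2 (wᴵ ι + rᴵ ι) (ℓᴵ ι * k ι))
                      (cong (_* 2 ^ (ℓᴵ ι * k ι)) (^-distribˡ-+-* 2 (wᴵ ι) (rᴵ ι)))) ⟨
        2 ^ (wᴵ ι + rᴵ ι + ℓᴵ ι * k ι) * (suc (N ι) * suc (k ι)) * poly reduction-time (mᴵ ι) ∎))
    where
    open ≤-Reasoning
    K = _∶_⟶_∈O_.κ reductionᴼ

    regroup : ∀ a b c d e g h K →
              K * (a * (b * (c * (d * (e * (g * h)))))) ≡ a * b * c * (e * d) * (K * g * h)
    regroup = solve-∀

  -- Covering and acceptance

  chosen : ∀ ι → Choice (length ∘ subset ι) → Vec (Bits (mᴵ ι)) (k ι)
  chosen ι S = Vec.tabulate λ j → lookup (subset ι j) (S j)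

  -- Adjacency to all of `S` forces a left vertex to be the tuple of messages sent on the chosen
  -- inputs, and the left vertices are exactly the accepted tuples.
  covers⇔accepts : ∀ ι μ S i →
    Covers (Γ ι μ) S i ⇔ T (accepts ι μ (chosen ι S) (lookup (allBits (rᴵ ι)) i))
  covers⇔accepts ι μ S i = mk⇔
    (λ (u , adj) → subst (T ∘ referee ι μ γ)
        (trans (sym (tabulate∘lookup (lookup (accepted ι μ γ) u)))
               (tabulateᵛ-cong λ j → sym (trans (sent j) (sameBits⇒≡ _ _ (adj j)))))
        (proj₂ (∈-filter⁻ (T? ∘ referee ι μ γ) {xs = tuples (ℓᴵ ι) (k ι)} (∈-lookup u))))
    -- The covering vertex is the position of the sent tuple among the accepted ones; every tuple
    -- occurs in `tuples`, so acceptance is all it needs.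
    (λ acc → let z∈ = ∈-filter⁺ (T? ∘ referee ι μ γ) (∈-tuples messages) acc in
        index z∈ , λ j → subst (λ y → T (sameBits (message ι j (lookup (subset ι j) (S j)) γ) y))
          (trans (sym (sent j)) (trans (sym (lookup∘tabulate _ j))
            (cong (λ z → Vec.lookup z j) (lookup-index z∈))))
          (sameBits-refl (message ι j (lookup (subset ι j) (S j)) γ)))
    where
    γ = lookup (allBits (rᴵ ι)) i

    messages : Vec (Bits (ℓᴵ ι)) (k ι)
    messages = Vec.tabulate λ j → message ι j (Vec.lookup (chosen ι S) j) γ

    sent : ∀ j → message ι j (Vec.lookup (chosen ι S) j) γ ≡ message ι j (lookup (subset ι j) (S j)) γ
    sent j = cong (λ x → message ι j x γ) (lookup∘tabulate _ j)

  covered≡acceptance : ∀ ι μ S →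
    coveredFraction (Γ ι μ) S ≡ acceptanceProbability ι μ (chosen ι S)
  covered≡acceptance ι μ S =
    ℚ./-cong {{length-allBits≢0 (rᴵ ι)}} {{m^n≢0 2 (rᴵ ι)}}
      (cong ℤ.+_ (trans
        (length-filter-tabulate (covers? (Γ ι μ) S) (λ γ → T? (accepts ι μ (chosen ι S) γ)) id
          (lookup (allBits (rᴵ ι))) (covers⇔accepts ι μ S))
        (cong (length ∘ filter (λ γ → T? (accepts ι μ (chosen ι S) γ))) (tabulate-lookup (allBits (rᴵ ι))))))
      (length-allBits (rᴵ ι))

  YES⇒MaxCover≡1 : ∀ ι → YES (f (N ι) (k ι)) (I ι) → ∃[ μ ] MaxCover (Γ ι μ) ≡ 1ℚ
  YES⇒MaxCover≡1 ι (a , a∈ , fa) =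
    let μ , accept       = complete (N ι) (k ι) a fa
        S , S∈ , S≡index = allChoices-complete (length ∘ subset ι) (index ∘ a∈)
        -- Pointwise equality of choices suffices, since `chosen` turns a choice into a vector.
        chosen≡a         = trans (tabulateᵛ-cong λ j → trans (cong (lookup (subset ι j)) (S≡index j))
                                                              (sym (lookup-index (a∈ j))))
                                 (tabulate∘lookup a)
        covered≡1        = trans (covered≡acceptance ι μ S)
                             (trans (cong (acceptanceProbability ι μ) chosen≡a) (certain ι μ a accept))
    in μ , ℚ.≤-antisym
      (maximum-preserves (ℚ._≤ 1ℚ) (coveredFraction (Γ ι μ)) (ℚ.nonNegative⁻¹ 1ℚ)
        (λ S → fraction≤1 _ _ {{length-allBits≢0 (rᴵ ι)}}
          (≤-trans (length-filter (covers? (Γ ι μ) S) (allFin (LabelCover.q (Γ ι μ)))) (≤-reflexive (length-tabulate id))))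
        (allChoices (length ∘ subset ι)))
      (subst (ℚ._≤ MaxCover (Γ ι μ)) covered≡1 (≤-maximum (coveredFraction (Γ ι μ)) S∈))
    where
    certain : ∀ ι μ x → (∀ γ → accepts ι μ x γ ≡ true) → acceptanceProbability ι μ x ≡ 1ℚ
    certain ι μ x accept = trans
      (ℚ./-cong {{m^n≢0 2 (rᴵ ι)}} {{m^n≢0 2 (rᴵ ι)}}
        (cong ℤ.+_ (trans (cong length (filter-all (λ γ → T? (accepts ι μ x γ))
                    (All.universal (λ γ → Equivalence.from T-≡ (accept γ)) (allBits (rᴵ ι)))))
                  (length-allBits (rᴵ ι)))) refl)
      (fraction≡1 (2 ^ rᴵ ι) {{m^n≢0 2 (rᴵ ι)}})

  -- Every labeling picks a point of the product of the subsets, where `f` is false, so soundness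
  -- applies. The bound `0 ≤ s` handles the starting value of the maximum, which is its value when
  -- some subset is empty; soundness cannot supply it, being vacuous if `f` is never false.
  NO⇒MaxCover≤s : ∀ ι → 0ℚ ≤ℝ s (N ι) (k ι) → NO (f (N ι) (k ι)) (I ι) →
                  ∀ μ → MaxCover (Γ ι μ) ≤ℝ s (N ι) (k ι)
  NO⇒MaxCover≤s ι 0≤s no-solution μ =
    maximum-preserves (_≤ℝ s (N ι) (k ι)) (coveredFraction (Γ ι μ)) 0≤s
      (λ S → subst (_≤ℝ s (N ι) (k ι)) (sym (covered≡acceptance ι μ S))
        (sound (N ι) (k ι) (chosen ι S) (rejected S) μ))
      (allChoices (length ∘ subset ι))
    where
    rejected : ∀ S → f (N ι) (k ι) (chosen ι S) ≡ false
    rejected S = ¬-not λ fx → no-solution (chosen ι S ,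
      (λ j → subst (_∈ subset ι j) (sym (lookup∘tabulate _ j)) (∈-lookup (S j))) , fx)

theorem5p2 : (m : ℕ → ℕ → ℕ)
    (f : ∀ N k → Vec (Bits (m N k)) k → Bool)
    (w r ℓ : ℕ → ℕ → ℕ)
    (s : ℕ → ℕ → ℝ) →
    (∀ N k → 0ℚ ≤ℝ s N k) →
    EfficientProtocols m f w r ℓ s →
    ∃[ reduction ] ∃[ p ]
    ∀ N k (I : Instance (m N k) k N) →
    Σ[ Γ ∈ (Bits (w N k) → LabelCover) ]
    Computes reduction
    (encList (encParams N k (m N k) (w N k) (r N k) (ℓ N k) ∷ encInstance I ∷ []))
    (encList (map (λ μ → encLabelCover (Γ μ)) (allBits (w N k))))
    (2 ^ (w N k + r N k + ℓ N k * k) * (suc N * suc k) * poly p (m N k))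
    × (∀ μ →
    sum (tabulate (LabelCover.right (Γ μ))) ≤ N * k
    × LabelCover.h (Γ μ) ≡ k
    × LabelCover.q (Γ μ) ≡ 2 ^ r N k
    × (∀ i → LabelCover.left (Γ μ) i ≤ 2 ^ (ℓ N k * k)))
    × (YES (f N k) I → ∃[ μ ] MaxCover (Γ μ) ≡ 1ℚ)
    × (NO (f N k) I → ∀ μ → MaxCover (Γ μ) ≤ℝ s N k)
theorem5p2 m f w r ℓ s 0≤s protocols =
  reductionP , reduction-time , λ N k I → let ι = input N k I in
    Γ ι , reduction-computes ι ,
    (λ μ → sum-tabulate≤ N (length ∘ subset ι) (Instance.card≤N I) , refl , length-allBits (r N k) ,
           λ i → accepted≤ ι μ (lookup (allBits (r N k)) i)) ,
    YES⇒MaxCover≡1 ι , NO⇒MaxCover≤s ι (0≤s N k)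
  where
  open Reduction m f w r ℓ s protocols
  open Input using (Γ; subset)
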